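{- Let $d\ge 1$ be an integer and $\varepsilon\in(0,1)$. Let $G$ be a finite abelian group, $A\subseteq G$, and $\delta=|A|/|G|$. (i) If $A$ is $\varepsilon$-uniform of degree $d$, i.e. $\|A-\delta\|_{U^{d+1}}\le\varepsilon$, then for every integer $k\ge d+1$ the Cayley hypergraph $\Gamma^{(k)}_A$ is $\varepsilon$-quasirandom of order $d$, i.e. $\|\Gamma^{(k)}_A-\delta\|_{\square^k_d}\le\varepsilon$. (ii) Conversely, if for some integer $k\ge d+1$ the hypergraph $\Gamma^{(k)}_A$ is $\varepsilon$-quasirandom of order $d$, then $A$ is $2\varepsilon^{c_{k,d}}$-uniform of degree $d$, i.e. $\|A-\delta\|_{U^{d+1}}\le 2\varepsilon^{c_{k,d}}$, where $c_{k,d}=2^{ -(d+2)(2d+2)^k}$.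
   Context: Sets are identified with their indicator functions; $\mathbb{E}_{x\in X}$ denotes the average $|X|^{ -1}\sum_{x\in X}$. For a finite abelian group $G$, an integer $m\ge 2$ and $f:G\to\mathbb{R}$, the Gowers uniformity norm is $\|f\|_{U^m}=\big(\mathbb{E}_{x,h_1,\dots,h_m\in G}\prod_{\omega\in\{0,1\}^m} f(x+\sum_{i=1}^m\omega_ih_i)\big)^{1/2^m}$. For $A\subseteq G$ with $\delta=|A|/|G|$, $A$ is called $\varepsilon$-uniform of degree $d$ if $\|A-\delta\|_{U^{d+1}}\le\varepsilon$. For integers $1\le d<k$, a finite set $V$ and $f:V^k\to\mathbb{R}$, the $d$-cut norm is $\|f\|_{\square^k_d}=\max\big|\mathbb{E}_{\mathbf{x}\in V^{k}}\big[f(\mathbf{x})\prod_{B\in\binom{[k]}{d}}S_B(\mathbf{x}_B)\big]\big|$, the maximum taken over all families of subsets $S_B\subseteq V^B$ ($B\in\binom{[k]}{d}$), where $\mathbf{x}_B=(x_j)_{j\in B}$. The Cayley $k$-graph $\Gamma^{(k)}_A$ of $A\subseteq G$ has vertex set $G$ and edge indicator function $\Gamma^{(k)}_A(x_1,\dots,x_k)=A(x_1+\dots+x_k)$ on $G^k$ (hypergraphs are allowed to have loops, i.e. edges are a symmetric subset of $V^k$); its edge density is $\delta=|A|/|G|$. A $k$-graph $H$ with edge density $\delta(H)$ is $\varepsilon$-quasirandom of order $d$ if $\|H-\delta(H)\|_{\square^k_d}\le\varepsilon$, where $H$ denotes its edge indicator function on $V(H)^k$. -}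

module Defs where

import Algebra.Definitions.RawSemiring
open import Algebra.Structures using (IsAbelianGroup)
open import Data.Bool.Base using (Bool; true; false; if_then_else_; _∨_)
import Data.Bool.Properties as Bool
open import Data.Fin.Base using (Fin)
import Data.Fin.Properties as Fin
open import Data.Fin.Subset using (Subset; ∣_∣)
open import Data.Integer.Base using (+_)
open import Data.List.Base using (List; []; _∷_; map; foldr; concatMap; cartesianProduct; filter; filterᵇ; length; allFin)
open import Data.List.Membership.Propositional using (_∈_; lose)
open import Data.List.Membership.Propositional.Properties using (∈-map⁺; ∈-concatMap⁺; ∈-allFin)
open import Data.List.Properties using (map-cong)
open import Data.List.Relation.Unary.Any using (here; there)
open import Data.Nat.Base as ℕ using (ℕ; zero; suc)
import Data.Nat.Properties as ℕ
open import Data.Product.Base using (Σ-syntax; ∃; ∃-syntax; _×_; _,_; proj₁; proj₂)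
import Data.Product.Properties as Product
open import Data.Rational.Base as ℚ using (ℚ; 0ℚ; 1ℚ; Positive; NonNegative; nonNegative; positive; 1/_)
import Data.Rational.Properties as ℚ
open import Data.Rational.Solver using (module +-*-Solver)
open import Data.Sum.Base using (_⊎_; inj₁; inj₂)
open import Data.Vec.Base as Vec using (Vec; []; _∷_; zipWith)
import Data.Vec.Properties as Vec
open import Function.Bundles using (_↔_; Inverse)
open import Function.Properties.Inverse using (↔⇒↣)
open import Relation.Binary.Definitions using (DecidableEquality)
open import Relation.Binary.PropositionalEquality using (_≡_; refl; sym; trans; cong; cong₂; subst)
open import Relation.Nullary.Decidable using (yes; no; does; via-injection)
open import Relation.Nullary.Negation using (¬_; contradiction)

open Algebra.Definitions.RawSemiring ℚ.+-*-rawSemiring using (_^_)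

-- Real numbers, as two-sided Dedekind cuts of ℚ.

record ℝ : Set₁ where
  field
    Lower Upper : ℚ → Set
    lower-inhabited : ∃ Lower
    upper-inhabited : ∃ Upper
    lower-closed    : ∀ {p q} → p ℚ.≤ q → Lower q → Lower p
    upper-closed    : ∀ {p q} → p ℚ.≤ q → Upper p → Upper q
    lower-open      : ∀ {p} → Lower p → ∃[ q ] p ℚ.< q × Lower q
    upper-open      : ∀ {q} → Upper q → ∃[ p ] p ℚ.< q × Upper p
    disjoint        : ∀ {q} → Lower q → ¬ Upper q
    located         : ∀ {p q} → p ℚ.< q → Lower p ⊎ Upper q

open ℝ

infix 4 _≤_ _<_

_≤_ : ℝ → ℝ → Set
x ≤ y = ∀ q → Lower x q → Lower y q

_<_ : ℝ → ℝ → Set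
x < y = ∃[ q ] Upper x q × Lower y q

fromℚ : ℚ → ℝ
fromℚ r = record
  { Lower           = ℚ._< r
  ; Upper           = r ℚ.<_
  ; lower-inhabited = r ℚ.- 1ℚ , subst (r ℚ.- 1ℚ ℚ.<_) (ℚ.+-identityʳ r) (ℚ.+-monoʳ-< r (ℚ.negative⁻¹ (ℚ.- 1ℚ)))
  ; upper-inhabited = r ℚ.+ 1ℚ , subst (ℚ._< r ℚ.+ 1ℚ) (ℚ.+-identityʳ r) (ℚ.+-monoʳ-< r (ℚ.positive⁻¹ 1ℚ))
  ; lower-closed    = ℚ.≤-<-trans
  ; upper-closed    = λ p≤q r<p → ℚ.<-≤-trans r<p p≤q
  ; lower-open      = λ p<r → let s , p<s , s<r = ℚ.<-dense p<r in s , p<s , s<r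
  ; upper-open      = λ r<q → let s , r<s , s<q = ℚ.<-dense r<q in s , s<q , r<s
  ; disjoint        = ℚ.<-asym
  ; located         = located′
  }
  where
  located′ : ∀ {p q} → p ℚ.< q → p ℚ.< r ⊎ r ℚ.< q
  located′ {p} p<q with p ℚ.<? r
  ... | yes p<r = inj₁ p<r
  ... | no  p≮r = inj₂ (ℚ.≤-<-trans (ℚ.≮⇒≥ p≮r) p<q)

0ℝ 1ℝ : ℝ
0ℝ = fromℚ 0ℚ
1ℝ = fromℚ 1ℚ

module _ (c : ℚ) .{{c>0 : Positive c}} where
  private
    instance
      c≢0 : ℚ.NonZero c
      c≢0 = ℚ.pos⇒nonZero c

      c≥0 : NonNegative c
      c≥0 = ℚ.pos⇒nonNeg c

      c⁻¹>0 : Positive (1/ c)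
      c⁻¹>0 = ℚ.1/pos⇒pos c

      c⁻¹≥0 : NonNegative (1/ c)
      c⁻¹≥0 = ℚ.pos⇒nonNeg (1/ c)

    *-÷ : ∀ p → p ℚ.* c ℚ.* 1/ c ≡ p
    *-÷ p = trans (ℚ.*-assoc p c (1/ c)) (trans (cong (p ℚ.*_) (ℚ.*-inverseʳ c)) (ℚ.*-identityʳ p))

    ÷-* : ∀ p → p ℚ.* 1/ c ℚ.* c ≡ p
    ÷-* p = trans (ℚ.*-assoc p (1/ c) c) (trans (cong (p ℚ.*_) (ℚ.*-inverseˡ c)) (ℚ.*-identityʳ p))

  infixr 7 _·_

  _·_ : ℝ → ℝ
  _·_ x = record
    { Lower           = λ q → Lower x (q ℚ.* 1/ c)
    ; Upper           = λ q → Upper x (q ℚ.* 1/ c)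
    ; lower-inhabited = let p , Lp = lower-inhabited x in p ℚ.* c , subst (Lower x) (sym (*-÷ p)) Lp
    ; upper-inhabited = let p , Up = upper-inhabited x in p ℚ.* c , subst (Upper x) (sym (*-÷ p)) Up
    ; lower-closed    = λ p≤q → lower-closed x (ℚ.*-monoʳ-≤-nonNeg (1/ c) p≤q)
    ; upper-closed    = λ p≤q → upper-closed x (ℚ.*-monoʳ-≤-nonNeg (1/ c) p≤q)
    ; lower-open      = λ {p} Lp → let s , p<s , Ls = lower-open x Lp in
        s ℚ.* c , subst (ℚ._< s ℚ.* c) (÷-* p) (ℚ.*-monoˡ-<-pos c p<s) , subst (Lower x) (sym (*-÷ s)) Ls
    ; upper-open      = λ {q} Uq → let s , s<q , Us = upper-open x Uq in
        s ℚ.* c , subst (s ℚ.* c ℚ.<_) (÷-* q) (ℚ.*-monoˡ-<-pos c s<q) , subst (Upper x) (sym (*-÷ s)) Us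
    ; disjoint        = disjoint x
    ; located         = λ p<q → located x (ℚ.*-monoˡ-<-pos (1/ c) p<q)
    }

*-mono : ∀ {p q r s} → 0ℚ ℚ.≤ p → 0ℚ ℚ.≤ s → p ℚ.≤ q → r ℚ.≤ s → p ℚ.* r ℚ.≤ q ℚ.* s
*-mono {p} {q} {r} {s} 0≤p 0≤s p≤q r≤s =
  ℚ.≤-trans (ℚ.*-monoˡ-≤-nonNeg p {{nonNegative 0≤p}} r≤s) (ℚ.*-monoʳ-≤-nonNeg s {{nonNegative 0≤s}} p≤q)

*-nonneg : ∀ {p q} → 0ℚ ℚ.≤ p → 0ℚ ℚ.≤ q → 0ℚ ℚ.≤ p ℚ.* q
*-nonneg {p} {q} 0≤p 0≤q = subst (ℚ._≤ p ℚ.* q) (ℚ.*-zeroʳ p) (ℚ.*-monoˡ-≤-nonNeg p {{nonNegative 0≤p}} 0≤q)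

0≤1 : 0ℚ ℚ.≤ 1ℚ
0≤1 = ℚ.nonNegative⁻¹ 1ℚ

^-nonneg : ∀ n {p} → 0ℚ ℚ.≤ p → 0ℚ ℚ.≤ p ^ n
^-nonneg zero    0≤p = 0≤1
^-nonneg (suc n) 0≤p = *-nonneg 0≤p (^-nonneg n 0≤p)

^-mono : ∀ n {p q} → 0ℚ ℚ.≤ p → p ℚ.≤ q → p ^ n ℚ.≤ q ^ n
^-mono zero    0≤p p≤q = ℚ.≤-refl
^-mono (suc n) 0≤p p≤q = *-mono 0≤p (^-nonneg n (ℚ.≤-trans 0≤p p≤q)) p≤q (^-mono n 0≤p p≤q)

^-pos : ∀ n {p} → 0ℚ ℚ.< p → 0ℚ ℚ.< p ^ n
^-pos zero        0<p = ℚ.positive⁻¹ 1ℚ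
^-pos (suc n) {p} 0<p = subst (ℚ._< p ℚ.* p ^ n) (ℚ.*-zeroʳ p) (ℚ.*-monoʳ-<-pos p {{positive 0<p}} (^-pos n 0<p))

^-mono-< : ∀ n {p q} → 0ℚ ℚ.≤ p → p ℚ.< q → p ^ suc n ℚ.< q ^ suc n
^-mono-< n {p} {q} 0≤p p<q = ℚ.≤-<-trans
  (ℚ.*-monoˡ-≤-nonNeg p {{nonNegative 0≤p}} (^-mono n 0≤p (ℚ.<⇒≤ p<q)))
  (ℚ.*-monoˡ-<-pos (q ^ n) {{positive (^-pos n (ℚ.≤-<-trans 0≤p p<q))}} p<q)

1≤^ : ∀ n {p} → 1ℚ ℚ.≤ p → 1ℚ ℚ.≤ p ^ n
1≤^ zero    1≤p = ℚ.≤-refl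
1≤^ (suc n) 1≤p = *-mono 0≤1 (ℚ.≤-trans 0≤1 (1≤^ n 1≤p)) 1≤p (1≤^ n 1≤p)

0≤q-p : ∀ {p q} → p ℚ.≤ q → 0ℚ ℚ.≤ q ℚ.- p
0≤q-p {p} {q} p≤q = subst (ℚ._≤ q ℚ.- p) (ℚ.+-inverseʳ p) (ℚ.+-monoˡ-≤ (ℚ.- p) p≤q)

0<q-p : ∀ {p q} → p ℚ.< q → 0ℚ ℚ.< q ℚ.- p
0<q-p {p} {q} p<q = subst (ℚ._< q ℚ.- p) (ℚ.+-inverseʳ p) (ℚ.+-monoˡ-< (ℚ.- p) p<q)

^-lipschitz : ∀ n K → 0ℚ ℚ.≤ K → ∃[ C ] 0ℚ ℚ.≤ C ×
  (∀ {p q} → 0ℚ ℚ.≤ p → p ℚ.≤ q → q ℚ.≤ K → q ^ n ℚ.≤ p ^ n ℚ.+ C ℚ.* (q ℚ.- p))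
^-lipschitz zero    K 0≤K = 0ℚ , ℚ.≤-refl , λ {p} {q} _ _ _ →
  ℚ.≤-reflexive (sym (trans (cong (1ℚ ℚ.+_) (ℚ.*-zeroˡ (q ℚ.- p))) (ℚ.+-identityʳ 1ℚ)))
^-lipschitz (suc n) K 0≤K =
  let C , 0≤C , bound = ^-lipschitz n K 0≤K in
  K ^ n ℚ.+ K ℚ.* C ,
  ℚ.+-mono-≤ (^-nonneg n 0≤K) (*-nonneg 0≤K 0≤C) ,
  λ {p} {q} 0≤p p≤q q≤K → begin
    q ℚ.* q ^ n
      ≤⟨ ℚ.*-monoˡ-≤-nonNeg q {{nonNegative (ℚ.≤-trans 0≤p p≤q)}} (bound 0≤p p≤q q≤K) ⟩
    q ℚ.* (p ^ n ℚ.+ C ℚ.* (q ℚ.- p))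
      ≡⟨ solve 4 (λ p q a C → q :* (a :+ C :* (q :- p)) := p :* a :+ (a :+ q :* C) :* (q :- p)) refl p q (p ^ n) C ⟩
    p ℚ.* p ^ n ℚ.+ (p ^ n ℚ.+ q ℚ.* C) ℚ.* (q ℚ.- p)
      ≤⟨ ℚ.+-monoʳ-≤ (p ℚ.* p ^ n) (ℚ.*-monoʳ-≤-nonNeg (q ℚ.- p) {{nonNegative (0≤q-p p≤q)}}
           (ℚ.+-mono-≤ (^-mono n 0≤p (ℚ.≤-trans p≤q q≤K)) (ℚ.*-monoʳ-≤-nonNeg C {{nonNegative 0≤C}} q≤K))) ⟩
    p ℚ.* p ^ n ℚ.+ (K ^ n ℚ.+ K ℚ.* C) ℚ.* (q ℚ.- p) ∎
  where
  open ℚ.≤-Reasoning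
  open +-*-Solver

small-step : ∀ {b C e} → 0ℚ ℚ.< b → 0ℚ ℚ.≤ C → 0ℚ ℚ.< e → ∃[ t ] 0ℚ ℚ.< t × t ℚ.< b × C ℚ.* t ℚ.< e
small-step {b} {C} {e} 0<b 0≤C 0<e =
  t , 0<t , ℚ.<-≤-trans t<m (ℚ.p⊓q≤p b s) , ℚ.≤-<-trans
    (ℚ.*-monoʳ-≤-nonNeg t {{nonNegative (ℚ.<⇒≤ 0<t)}} C≤D)
    (subst (D ℚ.* t ℚ.<_) D*s≡e (ℚ.*-monoʳ-<-pos D (ℚ.<-≤-trans t<m (ℚ.p⊓q≤q b s))))
  where
  D : ℚ
  D = C ℚ.+ 1ℚ
  C≤D : C ℚ.≤ D
  C≤D = subst (ℚ._≤ D) (ℚ.+-identityʳ C) (ℚ.+-monoʳ-≤ C 0≤1)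
  instance
    D>0 : Positive D
    D>0 = positive (ℚ.+-mono-≤-< 0≤C (ℚ.positive⁻¹ 1ℚ))
    D≢0 : ℚ.NonZero D
    D≢0 = ℚ.pos⇒nonZero D
  s : ℚ
  s = e ℚ.* 1/ D
  0<s : 0ℚ ℚ.< s
  0<s = subst (ℚ._< s) (ℚ.*-zeroˡ (1/ D)) (ℚ.*-monoˡ-<-pos (1/ D) {{ℚ.1/pos⇒pos D}} 0<e)
  D*s≡e : D ℚ.* s ≡ e
  D*s≡e = trans (ℚ.*-comm D s) (trans (ℚ.*-assoc e (1/ D) D) (trans (cong (e ℚ.*_) (ℚ.*-inverseˡ D)) (ℚ.*-identityʳ e)))
  0<m : 0ℚ ℚ.< b ℚ.⊓ s
  0<m with ℚ.⊓-sel b s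
  ... | inj₁ eq = subst (0ℚ ℚ.<_) (sym eq) 0<b
  ... | inj₂ eq = subst (0ℚ ℚ.<_) (sym eq) 0<s
  dense : ∃[ t ] 0ℚ ℚ.< t × t ℚ.< b ℚ.⊓ s
  dense = ℚ.<-dense 0<m
  t : ℚ
  t = proj₁ dense
  0<t : 0ℚ ℚ.< t
  0<t = proj₁ (proj₂ dense)
  t<m : t ℚ.< b ℚ.⊓ s
  t<m = proj₂ (proj₂ dense)

^-rightOpen : ∀ n {q r} → 0ℚ ℚ.≤ q → q ^ n ℚ.< r → ∃[ q′ ] q ℚ.< q′ × q′ ^ n ℚ.< r
^-rightOpen n {q} {r} 0≤q qⁿ<r =
  let C , 0≤C , bound       = ^-lipschitz n (q ℚ.+ 1ℚ) (ℚ.+-mono-≤ 0≤q 0≤1)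
      t , 0<t , t<1 , Ct<e  = small-step (ℚ.positive⁻¹ 1ℚ) 0≤C (0<q-p qⁿ<r)
      q<q+t                 = subst (ℚ._< q ℚ.+ t) (ℚ.+-identityʳ q) (ℚ.+-monoʳ-< q 0<t)
  in q ℚ.+ t , q<q+t , (begin-strict
    (q ℚ.+ t) ^ n                          ≤⟨ bound 0≤q (ℚ.<⇒≤ q<q+t) (ℚ.+-monoʳ-≤ q (ℚ.<⇒≤ t<1)) ⟩
    q ^ n ℚ.+ C ℚ.* (q ℚ.+ t ℚ.- q)        ≡⟨ solve 4 (λ a C q t → a :+ C :* (q :+ t :- q) := a :+ C :* t) refl (q ^ n) C q t ⟩
    q ^ n ℚ.+ C ℚ.* t                      <⟨ ℚ.+-monoʳ-< (q ^ n) Ct<e ⟩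
    q ^ n ℚ.+ (r ℚ.- q ^ n)                ≡⟨ solve 2 (λ a r → a :+ (r :- a) := r) refl (q ^ n) r ⟩
    r                                      ∎)
  where
  open ℚ.≤-Reasoning
  open +-*-Solver

^-leftOpen : ∀ n {q r} → 0ℚ ℚ.< q → r ℚ.< q ^ n → ∃[ q′ ] 0ℚ ℚ.< q′ × q′ ℚ.< q × r ℚ.< q′ ^ n
^-leftOpen n {q} {r} 0<q r<qⁿ =
  let C , 0≤C , bound       = ^-lipschitz n q (ℚ.<⇒≤ 0<q)
      t , 0<t , t<q , Ct<e  = small-step 0<q 0≤C (0<q-p r<qⁿ)
      q-t<q                 = subst (q ℚ.- t ℚ.<_) (ℚ.+-identityʳ q) (ℚ.+-monoʳ-< q (ℚ.neg-antimono-< 0<t))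
      0<q-t                 = 0<q-p t<q
  in q ℚ.- t , 0<q-t , q-t<q , (begin-strict
    r                                                          ≡⟨ solve 2 (λ a r → r := a :+ (:- (a :- r))) refl (q ^ n) r ⟩
    q ^ n ℚ.+ (ℚ.- (q ^ n ℚ.- r))                              <⟨ ℚ.+-monoʳ-< (q ^ n) (ℚ.neg-antimono-< Ct<e) ⟩
    q ^ n ℚ.+ (ℚ.- (C ℚ.* t))                                  ≤⟨ ℚ.+-monoˡ-≤ (ℚ.- (C ℚ.* t)) (bound (ℚ.<⇒≤ 0<q-t) (ℚ.<⇒≤ q-t<q) ℚ.≤-refl) ⟩
    (q ℚ.- t) ^ n ℚ.+ C ℚ.* (q ℚ.- (q ℚ.- t)) ℚ.- C ℚ.* t      ≡⟨ solve 4 (λ a C q t → a :+ C :* (q :- (q :- t)) :- C :* t := a) refl ((q ℚ.- t) ^ n) C q t ⟩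
    (q ℚ.- t) ^ n                                              ∎)
  where
  open ℚ.≤-Reasoning
  open +-*-Solver

-- The nonnegative n-th root of x for x ≥ 0 (and 0 for x < 0).

root : (n : ℕ) .{{_ : ℕ.NonZero n}} → ℝ → ℝ
root n@(suc m) x = record
  { Lower           = Lower′
  ; Upper           = Upper′
  ; lower-inhabited = ℚ.- 1ℚ , inj₁ (ℚ.negative⁻¹ (ℚ.- 1ℚ))
  ; upper-inhabited = upper-inhabited′
  ; lower-closed    = lower-closed′
  ; upper-closed    = λ (p≤q) (0<p , Up) → ℚ.<-≤-trans 0<p p≤q , upper-closed x (^-mono n (ℚ.<⇒≤ 0<p) p≤q) Up
  ; lower-open      = lower-open′
  ; upper-open      = λ (0<q , Uq) →
      let r , r<qⁿ , Ur          = upper-open x Uq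
          q′ , 0<q′ , q′<q , r<q′ = ^-leftOpen n 0<q r<qⁿ
      in q′ , q′<q , 0<q′ , upper-closed x (ℚ.<⇒≤ r<q′) Ur
  ; disjoint        = disjoint′
  ; located         = located′
  }
  where
  Lower′ Upper′ : ℚ → Set
  Lower′ q = q ℚ.< 0ℚ ⊎ (0ℚ ℚ.≤ q × Lower x (q ^ n))
  Upper′ q = 0ℚ ℚ.< q × Upper x (q ^ n)

  upper-inhabited′ : ∃ Upper′
  upper-inhabited′ =
    let u , Uu = upper-inhabited x
        q      = u ℚ.⊔ 1ℚ
        1≤q    = ℚ.p≤q⊔p u 1ℚ
        0≤q    = ℚ.≤-trans 0≤1 1≤q
        q≤qⁿ   = subst (ℚ._≤ q ^ n) (ℚ.*-identityʳ q) (ℚ.*-monoˡ-≤-nonNeg q {{nonNegative 0≤q}} (1≤^ m 1≤q))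
    in q , ℚ.<-≤-trans (ℚ.positive⁻¹ 1ℚ) 1≤q , upper-closed x (ℚ.≤-trans (ℚ.p≤p⊔q u 1ℚ) q≤qⁿ) Uu

  lower-closed′ : ∀ {p q} → p ℚ.≤ q → Lower′ q → Lower′ p
  lower-closed′ p≤q (inj₁ q<0) = inj₁ (ℚ.≤-<-trans p≤q q<0)
  lower-closed′ {p} p≤q (inj₂ (0≤q , Lq)) with p ℚ.<? 0ℚ
  ... | yes p<0 = inj₁ p<0
  ... | no  p≮0 = inj₂ (ℚ.≮⇒≥ p≮0 , lower-closed x (^-mono n (ℚ.≮⇒≥ p≮0) p≤q) Lq)

  lower-open′ : ∀ {p} → Lower′ p → ∃[ q ] p ℚ.< q × Lower′ q
  lower-open′ (inj₁ p<0) = let q , p<q , q<0 = ℚ.<-dense p<0 in q , p<q , inj₁ q<0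
  lower-open′ (inj₂ (0≤p , Lp)) =
    let r , pⁿ<r , Lr     = lower-open x Lp
        q , p<q , qⁿ<r    = ^-rightOpen n 0≤p pⁿ<r
    in q , p<q , inj₂ (ℚ.≤-trans 0≤p (ℚ.<⇒≤ p<q) , lower-closed x (ℚ.<⇒≤ qⁿ<r) Lr)

  disjoint′ : ∀ {q} → Lower′ q → ¬ Upper′ q
  disjoint′ (inj₁ q<0)       (0<q , _) = ℚ.<-asym q<0 0<q
  disjoint′ (inj₂ (_ , Lq))  (_ , Uq)  = disjoint x Lq Uq

  located′ : ∀ {p q} → p ℚ.< q → Lower′ p ⊎ Upper′ q
  located′ {p} p<q with p ℚ.<? 0ℚ
  ... | yes p<0 = inj₁ (inj₁ p<0)
  ... | no  p≮0 with located x (^-mono-< m (ℚ.≮⇒≥ p≮0) p<q)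
  ...   | inj₁ Lp = inj₁ (inj₂ (ℚ.≮⇒≥ p≮0 , Lp))
  ...   | inj₂ Uq = inj₂ (ℚ.≤-<-trans (ℚ.≮⇒≥ p≮0) p<q , Uq)

-- x ^½^ m is x raised to the power 2 ^ (- m).

infixr 8 _^½^_

_^½^_ : ℝ → ℕ → ℝ
x ^½^ m = root (2 ℕ.^ m) {{ℕ.m^n≢0 2 m}} x

private
  variable
    X V : Set
    m n k : ℕ

∑ ∏ 𝔼 max : List X → (X → ℚ) → ℚ
∑   xs f = foldr ℚ._+_ 0ℚ (map f xs)
∏   xs f = foldr ℚ._*_ 1ℚ (map f xs)
-- The value 0 for empty lists is a convention.
𝔼   []          f = 0ℚ
𝔼   xs@(_ ∷ _)  f = ∑ xs f ℚ.* (+ 1 ℚ./ length xs)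
-- Only used for nonnegative f.
max xs f = foldr ℚ._⊔_ 0ℚ (map f xs)

𝟙 : Bool → ℚ
𝟙 b = if b then 1ℚ else 0ℚ

vectors : List X → (n : ℕ) → List (Vec X n)
vectors xs zero    = [] ∷ []
vectors xs (suc n) = concatMap (λ x → map (x ∷_) (vectors xs n)) xs

-- All subsets of a list, as indicator functions vanishing off the list.
powerset : DecidableEquality X → List X → List (X → Bool)
powerset _≟_ []       = (λ _ → false) ∷ []
powerset _≟_ (x ∷ xs) = concatMap (λ S → S ∷ (λ y → does (y ≟ x) ∨ S y) ∷ []) (powerset _≟_ xs)

Finite : Set → ℕ → Set
Finite V n = V ↔ Fin n

elements : Finite V n → List V
elements {n = n} V-fin = map (Inverse.from V-fin) (allFin n)

decEq : Finite V n → DecidableEquality V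
decEq V-fin = via-injection (↔⇒↣ V-fin) Fin._≟_

bits : (m : ℕ) → List (Vec Bool m)
bits = vectors (false ∷ true ∷ [])

subsetsOfSize : (k d : ℕ) → List (Subset k)
subsetsOfSize k d = filter (λ B → ∣ B ∣ ℕ.≟ d) (bits k)

-- V ^ᴮ B is the set of functions B → V, listed in increasing order of index.

_^ᴮ_ : Set → Subset k → Set
V ^ᴮ B = Vec V ∣ B ∣

restrict : Vec V k → (B : Subset k) → V ^ᴮ B
restrict []       []          = []
restrict (x ∷ xs) (true ∷ B)  = x ∷ restrict xs B
restrict (x ∷ xs) (false ∷ B) = restrict xs B

-- A family of subsets S_B ⊆ V^B is a subset of the disjoint union of the V^B.

Family : Set → ℕ → Set
Family V k = (Σ[ B ∈ Subset k ] V ^ᴮ B) → Bool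

module _ (V-fin : Finite V n) where

  cells : (k d : ℕ) → List (Σ[ B ∈ Subset k ] V ^ᴮ B)
  cells k d = concatMap (λ B → map (B ,_) (vectors (elements V-fin) ∣ B ∣)) (subsetsOfSize k d)

  families : (k d : ℕ) → List (Family V k)
  families k d = powerset (Product.≡-dec (Vec.≡-dec Bool._≟_) (Vec.≡-dec (decEq V-fin))) (cells k d)

  cutCorrelation : (d : ℕ) → (Vec V k → ℚ) → Family V k → ℚ
  cutCorrelation {k} d f S =
    ℚ.∣ 𝔼 (vectors (elements V-fin) k) (λ x → f x ℚ.* ∏ (subsetsOfSize k d) (λ B → 𝟙 (S (B , restrict x B)))) ∣

  cutNorm : (d : ℕ) → (Vec V k → ℚ) → ℚ
  cutNorm {k} d f = max (families k d) (cutCorrelation d f)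

-- cutNorm is the maximum of cutCorrelation over all families, not only
-- the listed ones.

powerset-nonempty : (_≟_ : DecidableEquality X) (xs : List X) → ∃[ S ] S ∈ powerset _≟_ xs
powerset-nonempty _≟_ []       = _ , here refl
powerset-nonempty _≟_ (x ∷ xs) =
  let S , S∈ = powerset-nonempty _≟_ xs in
  S , ∈-concatMap⁺ (λ S → S ∷ (λ y → does (y ≟ x) ∨ S y) ∷ []) (lose S∈ (here refl))

powerset-complete : (_≟_ : DecidableEquality X) (xs : List X) (S : X → Bool) →
  ∃[ T ] T ∈ powerset _≟_ xs × (∀ {y} → y ∈ xs → T y ≡ S y) × (∀ y → S y ≡ false → T y ≡ false)
powerset-complete _≟_ [] S = _ , here refl , (λ ()) , λ _ _ → refl
powerset-complete {X = X} _≟_ (x ∷ xs) S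
  with powerset-complete _≟_ xs S
... | T , T∈ , agree , vanish with S x in Sx
...   | false = T , ∈-concatMap⁺ step (lose T∈ (here refl)) , agree′ , vanish
  where
  step : (X → Bool) → List (X → Bool)
  step S = S ∷ (λ y → does (y ≟ x) ∨ S y) ∷ []
  agree′ : ∀ {y} → y ∈ x ∷ xs → T y ≡ S y
  agree′ (here refl) = trans (vanish x Sx) (sym Sx)
  agree′ (there y∈)  = agree y∈
...   | true = T′ , ∈-concatMap⁺ step (lose T∈ (there (here refl))) , agree′ , vanish′
  where
  step : (X → Bool) → List (X → Bool)
  step S = S ∷ (λ y → does (y ≟ x) ∨ S y) ∷ []
  T′ : X → Bool
  T′ y = does (y ≟ x) ∨ T y
  agree′ : ∀ {y} → y ∈ x ∷ xs → T′ y ≡ S y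
  agree′ {y} y∈ with y ≟ x | y∈
  ... | yes refl | _          = sym Sx
  ... | no  y≢x  | here y≡x   = contradiction y≡x y≢x
  ... | no  _    | there y∈xs = agree y∈xs
  vanish′ : ∀ y → S y ≡ false → T′ y ≡ false
  vanish′ y Sy with y ≟ x
  ... | yes refl = contradiction (trans (sym Sx) Sy) λ ()
  ... | no  _    = vanish y Sy

max-upper : (xs : List X) (f : X → ℚ) {x : X} → x ∈ xs → f x ℚ.≤ max xs f
max-upper (x ∷ xs) f (here refl) = ℚ.p≤p⊔q (f x) (max xs f)
max-upper (x ∷ xs) f (there x∈)  = ℚ.≤-trans (max-upper xs f x∈) (ℚ.p≤q⊔p (f x) (max xs f))

max-attained : (xs : List X) (f : X → ℚ) → (∀ x → 0ℚ ℚ.≤ f x) → {x : X} → x ∈ xs → ∃[ y ] f y ≡ max xs f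
max-attained (x ∷ [])        f 0≤f _ = x , sym (ℚ.p≥q⇒p⊔q≡p (0≤f x))
max-attained (x ∷ ys@(_ ∷ _)) f 0≤f _ = select (max-attained ys f 0≤f (here refl)) (ℚ.⊔-sel (f x) (max ys f))
  where
  select : ∃[ z ] f z ≡ max ys f → max (x ∷ ys) f ≡ f x ⊎ max (x ∷ ys) f ≡ max ys f → ∃[ y ] f y ≡ max (x ∷ ys) f
  select _        (inj₁ eq) = x , sym eq
  select (z , fz) (inj₂ eq) = z , trans fz (sym eq)

vectors-complete : {xs : List X} → (∀ x → x ∈ xs) → (v : Vec X n) → v ∈ vectors xs n
vectors-complete all∈ []                = here refl
vectors-complete {xs = xs} all∈ (x ∷ v) =
  ∈-concatMap⁺ (λ x → map (x ∷_) (vectors xs _)) (lose (all∈ x) (∈-map⁺ (x ∷_) (vectors-complete all∈ v)))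

𝔼-cong : (xs : List X) {f g : X → ℚ} → (∀ x → f x ≡ g x) → 𝔼 xs f ≡ 𝔼 xs g
𝔼-cong []       eq = refl
𝔼-cong (x ∷ xs) eq = cong (λ ys → foldr ℚ._+_ 0ℚ ys ℚ.* (+ 1 ℚ./ length (x ∷ xs))) (map-cong eq (x ∷ xs))

∏-cong : (xs : List X) {f g : X → ℚ} → (∀ {x} → x ∈ xs → f x ≡ g x) → ∏ xs f ≡ ∏ xs g
∏-cong []       eq = refl
∏-cong (x ∷ xs) eq = cong₂ ℚ._*_ (eq (here refl)) (∏-cong xs λ x∈ → eq (there x∈))

module _ (V-fin : Finite V n) where

  elements-complete : (v : V) → v ∈ elements V-fin
  elements-complete v =
    subst (_∈ elements V-fin) (Inverse.strictlyInverseʳ V-fin v) (∈-map⁺ (Inverse.from V-fin) (∈-allFin (Inverse.to V-fin v)))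

  cutNorm-upper : (d : ℕ) (f : Vec V k → ℚ) (S : Family V k) → cutCorrelation V-fin d f S ℚ.≤ cutNorm V-fin d f
  cutNorm-upper {k} d f S =
    let T , T∈ , agree , _ = powerset-complete (Product.≡-dec (Vec.≡-dec Bool._≟_) (Vec.≡-dec (decEq V-fin))) (cells V-fin k d) S
    in subst (ℚ._≤ cutNorm V-fin d f)
         (cong ℚ.∣_∣ (𝔼-cong (vectors (elements V-fin) k) λ x → cong (f x ℚ.*_) (∏-cong (subsetsOfSize k d) λ {B} B∈ →
           cong 𝟙 (agree (∈-concatMap⁺ (λ B → map (B ,_) (vectors (elements V-fin) ∣ B ∣))
             (lose B∈ (∈-map⁺ (B ,_) (vectors-complete elements-complete (restrict x B)))))))))
         (max-upper (families V-fin k d) (cutCorrelation V-fin d f) T∈)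

  cutNorm-attained : (d : ℕ) (f : Vec V k → ℚ) → ∃[ S ] cutCorrelation V-fin d f S ≡ cutNorm V-fin d f
  cutNorm-attained {k} d f = max-attained (families V-fin k d) (cutCorrelation V-fin d f) (λ S → ℚ.0≤∣p∣ _)
    (proj₂ (powerset-nonempty (Product.≡-dec (Vec.≡-dec Bool._≟_) (Vec.≡-dec (decEq V-fin))) (cells V-fin k d)))

record FiniteAbelianGroup : Set₁ where
  infixl 6 _+_
  field
    Carrier        : Set
    _+_            : Carrier → Carrier → Carrier
    0#             : Carrier
    -_             : Carrier → Carrier
    isAbelianGroup : IsAbelianGroup _≡_ _+_ 0# -_
    size           : ℕ
    finite         : Finite Carrier size

  instance
    size-nonZero : ℕ.NonZero size
    size-nonZero = Fin.nonZeroIndex (Inverse.to finite 0#)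

  sum : Vec Carrier m → Carrier
  sum = Vec.foldr′ _+_ 0#

module _ (G : FiniteAbelianGroup) where
  open FiniteAbelianGroup G

  density : (Carrier → Bool) → ℚ
  density A = + length (filterᵇ A (elements finite)) ℚ./ size

  dot : Vec Bool m → Vec Carrier m → Carrier
  dot ω h = sum (zipWith (λ b g → if b then g else 0#) ω h)

  gowersAverage : (m : ℕ) → (Carrier → ℚ) → ℚ
  gowersAverage m f = 𝔼 (cartesianProduct (elements finite) (vectors (elements finite) m))
    λ (x , h) → ∏ (bits m) λ ω → f (x + dot ω h)

  -- gowersAverage m f is nonnegative for m ≥ 1, so the convention for roots
  -- of negative reals plays no part here.
  uniformityNorm : (m : ℕ) → (Carrier → ℚ) → ℝ
  uniformityNorm m f = fromℚ (gowersAverage m f) ^½^ m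

  cayley : (k : ℕ) → (Carrier → Bool) → Vec Carrier k → Bool
  cayley k A x = A (sum x)

{-# OPTIONS --safe #-}
module Submission where

open import Defs
open import Algebra.Bundles using (AbelianGroup; CommutativeRing)
import Algebra.Properties.CommutativeMonoid.Sum
import Algebra.Properties.Semiring.Exp
open import Data.Bool.Base using (Bool; true; false; if_then_else_; not)
import Data.Bool.Properties as Bool
open import Data.Fin.Base as Fin using (Fin)
open import Data.Fin.Subset as Subset using (Subset; ∣_∣)
open import Data.Fin.Subset.Properties using (∣⊤∣≡n)
open import Data.Integer.Base as ℤ using ()
import Data.Integer.Properties as ℤ
open import Data.List.Base using (List; []; _∷_; _++_; map; concatMap; cartesianProductWith; length; filter; filterᵇ; allFin; tabulate)
open import Data.List.Membership.Propositional using (_∈_; _∉_)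
open import Data.List.Membership.Propositional.Properties using (∈-filter⁺; ∈-filter⁻)
import Data.List.Properties as List
open import Data.List.Relation.Unary.All using (All; []; _∷_)
open import Data.List.Relation.Unary.All.Properties using (all-filter)
open import Data.List.Relation.Unary.Any using (here; there)
open import Data.Nat.Base as ℕ using (ℕ; zero; suc)
import Data.Nat.Properties as ℕ
open import Data.Product.Base using (Σ-syntax; ∃-syntax; _×_; _,_; proj₁; proj₂)
open import Data.Rational.Base as ℚ using (ℚ; 0ℚ; 1ℚ; _+_; _*_; _-_; -_; 1/_; nonNegative)
import Data.Rational.Properties as ℚ
open import Data.Rational.Solver using (module +-*-Solver)
import Data.Rational.Unnormalised.Base as ℚᵘ
import Data.Rational.Unnormalised.Properties as ℚᵘ
open import Data.Sum.Base using (_⊎_; inj₁; inj₂)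
open import Data.Unit.Base using (⊤)
open import Data.Vec.Base as Vec using (Vec; []; _∷_; zipWith; head; tail)
import Data.Vec.Properties as Vec
open import Function.Bundles using (_↔_; Inverse; mk↔ₛ′)
open import Function.Construct.Composition using (_↔-∘_)
open import Function.Construct.Symmetry using (↔-sym)
open import Relation.Binary.Definitions using (DecidableEquality)
open import Relation.Binary.PropositionalEquality using (_≡_; _≢_; refl; sym; trans; cong; cong₂; subst; subst₂; module ≡-Reasoning)
open import Relation.Nullary.Decidable using (Dec; yes; no; does; T?)
open import Relation.Nullary.Negation using (¬_; contradiction)
open import Relation.Unary using (Decidable)

-- Write f = 𝟙 A - δ and F(x) = f(x₁ + ⋯ + x_k) on G^k.
--
-- (i) A weight on d coordinates ignores one of any d + 1 given coordinates,
-- so d + 1 applications of Cauchy-Schwarz remove all the weights and leave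
-- the box average of F over d + 1 coordinates, which is ‖f‖ to the power
-- 2^(d+1) in U^(d+1) after a change of variables.
--
-- (ii) For k = d + 1 that box average is itself the correlation of F with
-- its dual function, an average of products of bounded functions of d
-- coordinates.  To pass from k to k + 1, suppose that F on G^k correlates
-- with weights u_B.  For each B containing the first coordinate let T be the
-- conditional expectation of F ∏_{C ≠ B} u_C on the coordinates in B.
-- Cauchy-Schwarz replaces u_B by T, and d + 1 further applications (the first
-- removes f, by translations preserving x₁ + ⋯ + x_k) replace T by the dual
-- function of (y, z, x) ↦ T(y + z, x).  That dual function is a function of
-- y + z, yet for fixed averaging variables it is a product of functions each
-- of which omits one of y, z and the other coordinates of B.  Once every B
-- containing the first coordinate is treated, writing x₁ = y + z yields a
-- correlation on G^(k+1) with functions of d coordinates.  Finally bounded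
-- weights are replaced by sets at the cost of a factor 2 each.

open Algebra.Properties.Semiring.Exp (CommutativeRing.semiring ℚ.+-*-commutativeRing) using (_^_; ^-assocʳ; ^-homo-*)
open +-*-Solver using (solve; _:=_; _:+_; _:*_; _:-_; :-_)
open ℝ

private
  variable
    X Y Z : Set
    k n : ℕ

-- Rational arithmetic and iterated squaring.

2ℚ ½ : ℚ
2ℚ = 1ℚ + 1ℚ
½ = 1/ 2ℚ

-p*-p≡p*p : ∀ p → (- p) * (- p) ≡ p * p
-p*-p≡p*p = solve 1 (λ p → (:- p) :* (:- p) := p :* p) refl

0≤p*p : ∀ p → 0ℚ ℚ.≤ p * p
0≤p*p p with ℚ.≤-total 0ℚ p
... | inj₁ 0≤p = *-nonneg 0≤p 0≤p
... | inj₂ p≤0 = subst (0ℚ ℚ.≤_) (-p*-p≡p*p p)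
                   (*-nonneg (ℚ.neg-antimono-≤ p≤0) (ℚ.neg-antimono-≤ p≤0))

0≤p≤1⇒p*p≤1 : ∀ {p} → 0ℚ ℚ.≤ p → p ℚ.≤ 1ℚ → p * p ℚ.≤ 1ℚ
0≤p≤1⇒p*p≤1 0≤p p≤1 = *-mono 0≤p 0≤1 p≤1 p≤1

p*p≤1⇒∣p∣≤1 : ∀ p → p * p ℚ.≤ 1ℚ → ℚ.∣ p ∣ ℚ.≤ 1ℚ
p*p≤1⇒∣p∣≤1 p p*p≤1 with ℚ.∣ p ∣ ℚ.≤? 1ℚ
... | yes ∣p∣≤1 = ∣p∣≤1
... | no  ∣p∣≰1 = contradiction (ℚ.<-≤-trans 1<∣p∣ (begin
    ℚ.∣ p ∣              ≡⟨ ℚ.*-identityʳ ℚ.∣ p ∣ ⟨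
    ℚ.∣ p ∣ * 1ℚ         ≤⟨ ℚ.*-monoˡ-≤-nonNeg ℚ.∣ p ∣ {{ℚ.∣-∣-nonNeg p}} (ℚ.<⇒≤ 1<∣p∣) ⟩
    ℚ.∣ p ∣ * ℚ.∣ p ∣    ≡⟨ ℚ.∣p*q∣≡∣p∣*∣q∣ p p ⟨
    ℚ.∣ p * p ∣          ≡⟨ ℚ.0≤p⇒∣p∣≡p (0≤p*p p) ⟩
    p * p                ≤⟨ p*p≤1 ⟩
    1ℚ                   ∎)) (ℚ.<-irrefl refl)
  where
  open ℚ.≤-Reasoning
  1<∣p∣ = ℚ.≰⇒> ∣p∣≰1

p≤∣p∣ : ∀ p → p ℚ.≤ ℚ.∣ p ∣
p≤∣p∣ p with ℚ.≤-total 0ℚ p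
... | inj₁ 0≤p = ℚ.≤-reflexive (sym (ℚ.0≤p⇒∣p∣≡p 0≤p))
... | inj₂ p≤0 = ℚ.≤-trans p≤0 (ℚ.0≤∣p∣ p)

*-sq : ∀ p q → (p * q) * (p * q) ≡ (p * p) * (q * q)
*-sq = solve 2 (λ p q → (p :* q) :* (p :* q) := (p :* p) :* (q :* q)) refl

*-interchange : ∀ p q r s → (p * q) * (r * s) ≡ (p * r) * (q * s)
*-interchange = solve 4 (λ p q r s → (p :* q) :* (r :* s) := (p :* r) :* (q :* s)) refl

*-leftComm : ∀ p q r → p * (q * r) ≡ q * (p * r)
*-leftComm = solve 3 (λ p q r → p :* (q :* r) := q :* (p :* r)) refl

infixr 8 _^2^_

-- Squaring m times, that is, the power 2^m. The base is squared first, so that `p ^2^ suc m`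
-- unfolds to `(p * p) ^2^ m`, where an application of Cauchy-Schwarz bounds `p * p`.
_^2^_ : ℚ → ℕ → ℚ
p ^2^ zero  = p
p ^2^ suc m = (p * p) ^2^ m

^2^≡^ : ∀ m p → p ^2^ m ≡ p ^ (2 ℕ.^ m)
^2^≡^ zero    p = sym (ℚ.*-identityʳ p)
^2^≡^ (suc m) p = trans (^2^≡^ m (p * p))
  (trans (cong (λ q → (p * q) ^ (2 ℕ.^ m)) (sym (ℚ.*-identityʳ p))) (^-assocʳ p 2 (2 ℕ.^ m)))

^2^-nonneg : ∀ m {p} → 0ℚ ℚ.≤ p → 0ℚ ℚ.≤ p ^2^ m
^2^-nonneg zero    0≤p = 0≤p
^2^-nonneg (suc m) 0≤p = ^2^-nonneg m (*-nonneg 0≤p 0≤p)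

^2^-mono : ∀ m {p q} → 0ℚ ℚ.≤ p → p ℚ.≤ q → p ^2^ m ℚ.≤ q ^2^ m
^2^-mono zero    0≤p p≤q = p≤q
^2^-mono (suc m) 0≤p p≤q = ^2^-mono m (*-nonneg 0≤p 0≤p) (*-mono 0≤p (ℚ.≤-trans 0≤p p≤q) p≤q p≤q)

^2^-+ : ∀ m l p → p ^2^ (m ℕ.+ l) ≡ (p ^2^ m) ^2^ l
^2^-+ zero    l p = refl
^2^-+ (suc m) l p = ^2^-+ m l (p * p)

^2^-suc-nonneg : ∀ m p → 0ℚ ℚ.≤ p ^2^ suc m
^2^-suc-nonneg m p = ^2^-nonneg m (0≤p*p p)

^2^-antitone : ∀ m {l p} → m ℕ.≤ l → 0ℚ ℚ.≤ p → p ℚ.≤ 1ℚ → p ^2^ l ℚ.≤ p ^2^ m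
^2^-antitone m {l} {p} m≤l 0≤p p≤1 = subst (λ l → p ^2^ l ℚ.≤ p ^2^ m) (ℕ.m+[n∸m]≡n m≤l)
    (subst (ℚ._≤ p ^2^ m) (sym (^2^-+ m (l ℕ.∸ m) p)) (shrink (l ℕ.∸ m) (^2^-nonneg m 0≤p) (^2^-≤1 m 0≤p p≤1)))
  where
  ^2^-≤1 : ∀ m {p} → 0ℚ ℚ.≤ p → p ℚ.≤ 1ℚ → p ^2^ m ℚ.≤ 1ℚ
  ^2^-≤1 zero    0≤p p≤1 = p≤1
  ^2^-≤1 (suc m) 0≤p p≤1 = ^2^-≤1 m (*-nonneg 0≤p 0≤p) (0≤p≤1⇒p*p≤1 0≤p p≤1)
  shrink : ∀ j {q} → 0ℚ ℚ.≤ q → q ℚ.≤ 1ℚ → q ^2^ j ℚ.≤ q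
  shrink zero    0≤q q≤1 = ℚ.≤-refl
  shrink (suc j) {q} 0≤q q≤1 = ℚ.≤-trans (shrink j (*-nonneg 0≤q 0≤q) (0≤p≤1⇒p*p≤1 0≤q q≤1))
    (subst (q * q ℚ.≤_) (ℚ.*-identityʳ q) (ℚ.*-monoˡ-≤-nonNeg q {{nonNegative 0≤q}} q≤1))

^2^-mono-< : ∀ m {p q} → 0ℚ ℚ.≤ p → p ℚ.< q → p ^2^ m ℚ.< q ^2^ m
^2^-mono-< zero    0≤p p<q = p<q
^2^-mono-< (suc m) {p} {q} 0≤p p<q = ^2^-mono-< m (*-nonneg 0≤p 0≤p) (ℚ.≤-<-trans
  (ℚ.*-monoˡ-≤-nonNeg p {{nonNegative 0≤p}} (ℚ.<⇒≤ p<q))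
  (ℚ.*-monoˡ-<-pos q {{ℚ.positive (ℚ.≤-<-trans 0≤p p<q)}} p<q))

^2^-* : ∀ m p q → (p * q) ^2^ m ≡ p ^2^ m * q ^2^ m
^2^-* zero    p q = refl
^2^-* (suc m) p q = trans (cong (_^2^ m) (*-sq p q)) (^2^-* m (p * p) (q * q))

∣∣^2^ : ∀ m p → ℚ.∣ p ∣ ^2^ suc m ≡ p ^2^ suc m
∣∣^2^ m p = cong (_^2^ m) (trans (sym (ℚ.∣p*q∣≡∣p∣*∣q∣ p p)) (ℚ.0≤p⇒∣p∣≡p (0≤p*p p)))

-- Sums, products and averages over lists

∑-cong : (xs : List X) {f g : X → ℚ} → (∀ x → f x ≡ g x) → ∑ xs f ≡ ∑ xs g
∑-cong []       eq = refl
∑-cong (x ∷ xs) eq = cong₂ _+_ (eq x) (∑-cong xs eq)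

∑-+ : (xs : List X) (f g : X → ℚ) → ∑ xs (λ x → f x + g x) ≡ ∑ xs f + ∑ xs g
∑-+ []       f g = refl
∑-+ (x ∷ xs) f g = trans (cong (f x + g x +_) (∑-+ xs f g))
  (solve 4 (λ a b c d → a :+ b :+ (c :+ d) := a :+ c :+ (b :+ d)) refl (f x) (g x) (∑ xs f) (∑ xs g))

∑-*ˡ : (xs : List X) (c : ℚ) (f : X → ℚ) → ∑ xs (λ x → c * f x) ≡ c * ∑ xs f
∑-*ˡ []       c f = sym (ℚ.*-zeroʳ c)
∑-*ˡ (x ∷ xs) c f = trans (cong (c * f x +_) (∑-*ˡ xs c f)) (sym (ℚ.*-distribˡ-+ c (f x) (∑ xs f)))

∑-mono : (xs : List X) {f g : X → ℚ} → (∀ x → f x ℚ.≤ g x) → ∑ xs f ℚ.≤ ∑ xs g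
∑-mono []       f≤g = ℚ.≤-refl
∑-mono (x ∷ xs) f≤g = ℚ.+-mono-≤ (f≤g x) (∑-mono xs f≤g)

∑-zero : (xs : List X) → ∑ xs (λ _ → 0ℚ) ≡ 0ℚ
∑-zero []       = refl
∑-zero (x ∷ xs) = trans (ℚ.+-identityˡ _) (∑-zero xs)

∑-swap : (xs : List X) (ys : List Y) (f : X → Y → ℚ) → ∑ xs (λ x → ∑ ys (f x)) ≡ ∑ ys (λ y → ∑ xs (λ x → f x y))
∑-swap []       ys f = sym (∑-zero ys)
∑-swap (x ∷ xs) ys f = trans (cong (∑ ys (f x) +_) (∑-swap xs ys f)) (sym (∑-+ ys (f x) _))

∑-++ : (xs ys : List X) (f : X → ℚ) → ∑ (xs ++ ys) f ≡ ∑ xs f + ∑ ys f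
∑-++ []       ys f = sym (ℚ.+-identityˡ _)
∑-++ (x ∷ xs) ys f = trans (cong (f x +_) (∑-++ xs ys f)) (sym (ℚ.+-assoc (f x) _ _))

∑-map : (g : X → Y) (xs : List X) (f : Y → ℚ) → ∑ (map g xs) f ≡ ∑ xs (λ x → f (g x))
∑-map g []       f = refl
∑-map g (x ∷ xs) f = cong (f (g x) +_) (∑-map g xs f)

∑-cartesianProductWith : (g : X → Y → Z) (xs : List X) (ys : List Y) (f : Z → ℚ) →
  ∑ (cartesianProductWith g xs ys) f ≡ ∑ xs (λ x → ∑ ys (λ y → f (g x y)))
∑-cartesianProductWith g []       ys f = refl
∑-cartesianProductWith g (x ∷ xs) ys f = trans (∑-++ (map (g x) ys) _ f)
  (cong₂ _+_ (∑-map (g x) ys f) (∑-cartesianProductWith g xs ys f))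

-- The value at zero agrees with the convention for `𝔼` on the empty list, so `𝔼≡∑*recip` holds for
-- every list.
recip : ℕ → ℚ
recip zero    = 0ℚ
recip (suc n) = ℤ.+ 1 ℚ./ suc n

recip-nonneg : ∀ n → 0ℚ ℚ.≤ recip n
recip-nonneg zero    = ℚ.≤-refl
recip-nonneg (suc n) = ℚ.nonNegative⁻¹ _ {{ℚ.normalize-nonNeg 1 (suc n)}}

∑-one : (xs : List X) → ∑ xs (λ _ → 1ℚ) ≡ ℤ.+ length xs ℚ./ 1
∑-one []       = refl
∑-one (x ∷ xs) = trans (cong (1ℚ +_) (∑-one xs)) (ℚ.toℚᵘ-injective (begin
    ℚ.toℚᵘ (1ℚ + ℤ.+ length xs ℚ./ 1)                   ≈⟨ ℚ.toℚᵘ-homo-+ 1ℚ (ℤ.+ length xs ℚ./ 1) ⟩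
    ℚᵘ.1ℚᵘ ℚᵘ.+ ℚ.toℚᵘ (ℤ.+ length xs ℚ./ 1)            ≈⟨ ℚᵘ.+-congʳ ℚᵘ.1ℚᵘ (ℚ.toℚᵘ-fromℚᵘ (ℚᵘ.mkℚᵘ (ℤ.+ length xs) 0)) ⟩
    ℚᵘ.1ℚᵘ ℚᵘ.+ ℚᵘ.mkℚᵘ (ℤ.+ length xs) 0              ≈⟨ ℚᵘ.*≡* (cong (ℤ._* ℤ.+ 1) (cong (λ i → ℤ.+ 1 ℤ.+ i) (ℤ.*-identityʳ (ℤ.+ length xs)))) ⟩
    ℚᵘ.mkℚᵘ (ℤ.+ suc (length xs)) 0                     ≈⟨ ℚ.toℚᵘ-fromℚᵘ (ℚᵘ.mkℚᵘ (ℤ.+ suc (length xs)) 0) ⟨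
    ℚ.toℚᵘ (ℤ.+ suc (length xs) ℚ./ 1)                  ∎))
  where open ℚᵘ.≃-Reasoning

n*recip : ∀ n .{{_ : ℕ.NonZero n}} → (ℤ.+ n ℚ./ 1) * recip n ≡ 1ℚ
n*recip (suc n) = ℚ.toℚᵘ-injective (begin
    ℚ.toℚᵘ ((ℤ.+ suc n ℚ./ 1) * (ℤ.+ 1 ℚ./ suc n))              ≈⟨ ℚ.toℚᵘ-homo-* (ℤ.+ suc n ℚ./ 1) (ℤ.+ 1 ℚ./ suc n) ⟩
    ℚ.toℚᵘ (ℤ.+ suc n ℚ./ 1) ℚᵘ.* ℚ.toℚᵘ (ℤ.+ 1 ℚ./ suc n)      ≈⟨ ℚᵘ.*-cong (ℚ.toℚᵘ-fromℚᵘ (ℚᵘ.mkℚᵘ (ℤ.+ suc n) 0)) (ℚ.toℚᵘ-fromℚᵘ (ℚᵘ.mkℚᵘ (ℤ.+ 1) n)) ⟩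
    ℚᵘ.mkℚᵘ (ℤ.+ suc n) 0 ℚᵘ.* ℚᵘ.mkℚᵘ (ℤ.+ 1) n                ≈⟨ ℚᵘ.*≡* (trans (ℤ.*-identityʳ _) (trans (ℤ.*-comm (ℤ.+ suc n) (ℤ.+ 1)) (cong (λ m → ℤ.+ 1 ℤ.* ℤ.+ m) (sym (ℕ.*-identityˡ (suc n)))))) ⟩
    ℚᵘ.1ℚᵘ                                                   ∎)
  where open ℚᵘ.≃-Reasoning

𝔼≡∑*recip : (xs : List X) (f : X → ℚ) → 𝔼 xs f ≡ ∑ xs f * recip (length xs)
𝔼≡∑*recip []       f = refl
𝔼≡∑*recip (x ∷ xs) f = refl

𝔼-+ : (xs : List X) (f g : X → ℚ) → 𝔼 xs (λ x → f x + g x) ≡ 𝔼 xs f + 𝔼 xs g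
𝔼-+ []          f g = refl
𝔼-+ xs@(_ ∷ _)  f g = trans (cong (_* recip (length xs)) (∑-+ xs f g)) (ℚ.*-distribʳ-+ _ (∑ xs f) (∑ xs g))

𝔼-*ˡ : (xs : List X) (c : ℚ) (f : X → ℚ) → 𝔼 xs (λ x → c * f x) ≡ c * 𝔼 xs f
𝔼-*ˡ []          c f = sym (ℚ.*-zeroʳ c)
𝔼-*ˡ xs@(_ ∷ _)  c f = trans (cong (_* recip (length xs)) (∑-*ˡ xs c f)) (ℚ.*-assoc c (∑ xs f) _)

𝔼-*ʳ : (xs : List X) (c : ℚ) (f : X → ℚ) → 𝔼 xs (λ x → f x * c) ≡ 𝔼 xs f * c
𝔼-*ʳ xs c f = trans (𝔼-cong xs λ x → ℚ.*-comm (f x) c) (trans (𝔼-*ˡ xs c f) (ℚ.*-comm c _))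

𝔼-mono : (xs : List X) {f g : X → ℚ} → (∀ x → f x ℚ.≤ g x) → 𝔼 xs f ℚ.≤ 𝔼 xs g
𝔼-mono []          f≤g = ℚ.≤-refl
𝔼-mono xs@(_ ∷ _)  f≤g = ℚ.*-monoʳ-≤-nonNeg (recip (length xs)) {{nonNegative (recip-nonneg (length xs))}} (∑-mono xs f≤g)

𝔼-swap : (xs : List X) (ys : List Y) (f : X → Y → ℚ) → 𝔼 xs (λ x → 𝔼 ys (f x)) ≡ 𝔼 ys (λ y → 𝔼 xs (λ x → f x y))
𝔼-swap xs ys f = begin
    𝔼 xs (λ x → 𝔼 ys (f x))                 ≡⟨ expand xs ys f ⟩
    ∑ xs (λ x → ∑ ys (f x)) * (a * b)       ≡⟨ cong₂ _*_ (∑-swap xs ys f) (ℚ.*-comm a b) ⟩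
    ∑ ys (λ y → ∑ xs (λ x → f x y)) * (b * a) ≡⟨ expand ys xs (λ y x → f x y) ⟨
    𝔼 ys (λ y → 𝔼 xs (λ x → f x y))         ∎
  where
  open ≡-Reasoning
  a = recip (length xs)
  b = recip (length ys)
  expand : ∀ {X Y : Set} (xs : List X) (ys : List Y) (f : X → Y → ℚ) →
    𝔼 xs (λ x → 𝔼 ys (f x)) ≡ ∑ xs (λ x → ∑ ys (f x)) * (recip (length xs) * recip (length ys))
  expand xs ys f = begin
    𝔼 xs (λ x → 𝔼 ys (f x))                               ≡⟨ 𝔼-cong xs (λ x → 𝔼≡∑*recip ys (f x)) ⟩
    𝔼 xs (λ x → ∑ ys (f x) * recip (length ys))            ≡⟨ 𝔼-*ʳ xs _ _ ⟩
    𝔼 xs (λ x → ∑ ys (f x)) * recip (length ys)            ≡⟨ cong (_* recip (length ys)) (𝔼≡∑*recip xs _) ⟩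
    ∑ xs (λ x → ∑ ys (f x)) * recip (length xs) * recip (length ys) ≡⟨ ℚ.*-assoc (∑ xs (λ x → ∑ ys (f x))) _ _ ⟩
    ∑ xs (λ x → ∑ ys (f x)) * (recip (length xs) * recip (length ys)) ∎

-- Nonemptiness of the list, in the form in which averages use it.
record Normalised (xs : List X) : Set where
  constructor normalised
  field total : 𝔼 xs (λ _ → 1ℚ) ≡ 1ℚ

open Normalised

nonempty⇒normalised : (xs : List X) .{{_ : ℕ.NonZero (length xs)}} → Normalised xs
nonempty⇒normalised xs = normalised (trans (𝔼≡∑*recip xs _) (trans (cong (_* recip (length xs)) (∑-one xs)) (n*recip (length xs))))

𝔼-const : {xs : List X} → Normalised xs → ∀ c → 𝔼 xs (λ _ → c) ≡ c
𝔼-const {xs = xs} norm c = begin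
    𝔼 xs (λ _ → c)        ≡⟨ 𝔼-cong xs (λ _ → ℚ.*-identityʳ c) ⟨
    𝔼 xs (λ _ → c * 1ℚ)   ≡⟨ 𝔼-*ˡ xs c _ ⟩
    c * 𝔼 xs (λ _ → 1ℚ)   ≡⟨ cong (c *_) (total norm) ⟩
    c * 1ℚ                ≡⟨ ℚ.*-identityʳ c ⟩
    c                     ∎
  where open ≡-Reasoning

𝔼-≤ : {xs : List X} → Normalised xs → ∀ {c} {f : X → ℚ} → (∀ x → f x ℚ.≤ c) → 𝔼 xs f ℚ.≤ c
𝔼-≤ {xs = xs} norm {c} f≤c = ℚ.≤-trans (𝔼-mono xs f≤c) (ℚ.≤-reflexive (𝔼-const norm c))

𝔼-nonneg : {xs : List X} → Normalised xs → {f : X → ℚ} → (∀ x → 0ℚ ℚ.≤ f x) → 0ℚ ℚ.≤ 𝔼 xs f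
𝔼-nonneg {xs = xs} norm 0≤f = ℚ.≤-trans (ℚ.≤-reflexive (sym (𝔼-const norm 0ℚ))) (𝔼-mono xs 0≤f)

𝔼-∣∣ : (xs : List X) (f : X → ℚ) → ℚ.∣ 𝔼 xs f ∣ ℚ.≤ 𝔼 xs (λ x → ℚ.∣ f x ∣)
𝔼-∣∣ xs f with ℚ.∣p∣≡p∨∣p∣≡-p (𝔼 xs f)
... | inj₁ eq = ℚ.≤-trans (ℚ.≤-reflexive eq) (𝔼-mono xs λ x → p≤∣p∣ (f x))
... | inj₂ eq = begin
    ℚ.∣ 𝔼 xs f ∣               ≡⟨ eq ⟩
    - 𝔼 xs f                   ≡⟨ trans (𝔼-*ˡ xs (- 1ℚ) f) (neg1* (𝔼 xs f)) ⟨
    𝔼 xs (λ x → (- 1ℚ) * f x)  ≤⟨ 𝔼-mono xs (λ x → begin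
      (- 1ℚ) * f x             ≡⟨ neg1* (f x) ⟩
      - f x                    ≤⟨ p≤∣p∣ (- f x) ⟩
      ℚ.∣ - f x ∣              ≡⟨ ℚ.∣-p∣≡∣p∣ (f x) ⟩
      ℚ.∣ f x ∣                ∎) ⟩
    𝔼 xs (λ x → ℚ.∣ f x ∣)     ∎
  where
  open ℚ.≤-Reasoning
  neg1* : ∀ p → (- 1ℚ) * p ≡ - p
  neg1* p = trans (sym (ℚ.neg-distribˡ-* 1ℚ p)) (cong -_ (ℚ.*-identityˡ p))

-- The variance, which is the average of `(f x - e) * (f x - e)`, is nonnegative.
𝔼-sq : {xs : List X} → Normalised xs → (f : X → ℚ) → 𝔼 xs f * 𝔼 xs f ℚ.≤ 𝔼 xs (λ x → f x * f x)
𝔼-sq {xs = xs} norm f = begin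
    e * e
      ≡⟨ ℚ.+-identityʳ (e * e) ⟨
    e * e + 0ℚ
      ≤⟨ ℚ.+-monoʳ-≤ (e * e) (𝔼-nonneg norm λ x → 0≤p*p (f x - e)) ⟩
    e * e + 𝔼 xs (λ x → (f x - e) * (f x - e))
      ≡⟨ cong (e * e +_) (𝔼-cong xs λ x → solve 2 (λ a e → (a :- e) :* (a :- e) := a :* a :+ ((:- (e :+ e)) :* a :+ e :* e)) refl (f x) e) ⟩
    e * e + 𝔼 xs (λ x → f x * f x + ((- (e + e)) * f x + e * e))
      ≡⟨ cong (e * e +_) (trans (𝔼-+ xs _ _) (cong (𝔼 xs (λ x → f x * f x) +_)
           (trans (𝔼-+ xs _ _) (cong₂ _+_ (𝔼-*ˡ xs (- (e + e)) f) (𝔼-const norm (e * e)))))) ⟩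
    e * e + (𝔼 xs (λ x → f x * f x) + ((- (e + e)) * e + e * e))
      ≡⟨ solve 2 (λ e s → e :* e :+ (s :+ ((:- (e :+ e)) :* e :+ e :* e)) := s) refl e (𝔼 xs (λ x → f x * f x)) ⟩
    𝔼 xs (λ x → f x * f x) ∎
  where
  open ℚ.≤-Reasoning
  e = 𝔼 xs f

𝔼-^2^ : {xs : List X} → Normalised xs → ∀ m (f : X → ℚ) → 𝔼 xs f ^2^ m ℚ.≤ 𝔼 xs (λ x → f x ^2^ m)
𝔼-^2^ norm zero    f = ℚ.≤-refl
𝔼-^2^ {xs = xs} norm (suc m) f = ℚ.≤-trans (^2^-mono m (0≤p*p (𝔼 xs f)) (𝔼-sq norm f)) (𝔼-^2^ norm m (λ x → f x * f x))

-- The form of Cauchy-Schwarz used throughout: squaring discards a bounded factor.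
𝔼-sq-*-≤ : {xs : List X} → Normalised xs → (u g : X → ℚ) → (∀ x → u x * u x ℚ.≤ 1ℚ) →
  𝔼 xs (λ x → u x * g x) * 𝔼 xs (λ x → u x * g x) ℚ.≤ 𝔼 xs (λ x → g x * g x)
𝔼-sq-*-≤ {xs = xs} norm u g u²≤1 = ℚ.≤-trans (𝔼-sq norm (λ x → u x * g x)) (𝔼-mono xs λ x → begin
    (u x * g x) * (u x * g x)  ≡⟨ *-sq (u x) (g x) ⟩
    (u x * u x) * (g x * g x)  ≤⟨ ℚ.*-monoʳ-≤-nonNeg (g x * g x) {{nonNegative (0≤p*p (g x))}} (u²≤1 x) ⟩
    1ℚ * (g x * g x)           ≡⟨ ℚ.*-identityˡ _ ⟩
    g x * g x                  ∎)
  where open ℚ.≤-Reasoning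

𝔼-cartesianProductWith : {xs : List X} {ys : List Y} → Normalised xs → Normalised ys → (g : X → Y → Z) (f : Z → ℚ) →
  𝔼 (cartesianProductWith g xs ys) f ≡ 𝔼 xs (λ x → 𝔼 ys (λ y → f (g x y)))
𝔼-cartesianProductWith {xs = xs} {ys} nx ny g f = begin
    𝔼 zs f                                              ≡⟨ 𝔼≡∑*recip zs f ⟩
    ∑ zs f * c                                          ≡⟨ cong₂ _*_ (∑-cartesianProductWith g xs ys f) c≡ba ⟩
    ∑ xs (λ x → ∑ ys (λ y → f (g x y))) * (b * a)       ≡⟨ ℚ.*-assoc (∑ xs (λ x → ∑ ys (λ y → f (g x y)))) b a ⟨
    ∑ xs (λ x → ∑ ys (λ y → f (g x y))) * b * a         ≡⟨ cong (_* a) (trans (ℚ.*-comm _ b) (sym (∑-*ˡ xs b _))) ⟩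
    ∑ xs (λ x → b * ∑ ys (λ y → f (g x y))) * a         ≡⟨ 𝔼≡∑*recip xs _ ⟨
    𝔼 xs (λ x → b * ∑ ys (λ y → f (g x y)))             ≡⟨ 𝔼-cong xs (λ x → trans (ℚ.*-comm b _) (sym (𝔼≡∑*recip ys _))) ⟩
    𝔼 xs (λ x → 𝔼 ys (λ y → f (g x y)))                 ∎
  where
  open ≡-Reasoning
  zs = cartesianProductWith g xs ys
  a = recip (length xs)
  b = recip (length ys)
  c = recip (length zs)
  N = ∑ xs (λ _ → 1ℚ)
  M = ∑ ys (λ _ → 1ℚ)
  Na≡1 : N * a ≡ 1ℚ
  Na≡1 = trans (sym (𝔼≡∑*recip xs _)) (total nx)
  Mb≡1 : M * b ≡ 1ℚ
  Mb≡1 = trans (sym (𝔼≡∑*recip ys _)) (total ny)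
  nonempty : ∀ {X : Set} (xs : List X) → Normalised xs → ℕ.NonZero (length xs)
  nonempty []       eq = contradiction (total eq) λ ()
  nonempty (_ ∷ _)  eq = _
  product-nonempty : ∀ xs ys → ℕ.NonZero (length xs) → ℕ.NonZero (length ys) → ℕ.NonZero (length (cartesianProductWith g xs ys))
  product-nonempty (_ ∷ _) (_ ∷ _) _ _ = _
  NMc≡1 : N * M * c ≡ 1ℚ
  NMc≡1 = begin
    N * M * c                            ≡⟨ cong (_* c) (trans (ℚ.*-comm N M) (sym (∑-*ˡ xs M _))) ⟩
    ∑ xs (λ _ → M * 1ℚ) * c              ≡⟨ cong (_* c) (∑-cong xs λ _ → ℚ.*-identityʳ M) ⟩
    ∑ xs (λ _ → M) * c                   ≡⟨ cong (_* c) (∑-cartesianProductWith g xs ys (λ _ → 1ℚ)) ⟨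
    ∑ zs (λ _ → 1ℚ) * c                  ≡⟨ 𝔼≡∑*recip zs _ ⟨
    𝔼 zs (λ _ → 1ℚ)                      ≡⟨ total (nonempty⇒normalised zs {{product-nonempty xs ys (nonempty xs nx) (nonempty ys ny)}}) ⟩
    1ℚ                                   ∎
  -- Each reciprocal is determined by its product with a sum of ones, so the length of the product
  -- list need not be computed.
  c≡ba : c ≡ b * a
  c≡ba = begin
    c                            ≡⟨ trans (sym (ℚ.*-identityˡ c)) (sym (ℚ.*-identityˡ (1ℚ * c))) ⟩
    1ℚ * (1ℚ * c)                ≡⟨ cong₂ (λ p q → p * (q * c)) Na≡1 Mb≡1 ⟨
    N * a * (M * b * c)          ≡⟨ solve 5 (λ N a M b c → N :* a :* (M :* b :* c) := b :* a :* (N :* M :* c)) refl N a M b c ⟩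
    b * a * (N * M * c)          ≡⟨ cong (b * a *_) NMc≡1 ⟩
    b * a * 1ℚ                   ≡⟨ ℚ.*-identityʳ (b * a) ⟩
    b * a                        ∎

concatMap≡cartesianProductWith : (g : X → Y → Z) (xs : List X) (ys : List Y) →
  concatMap (λ x → map (g x) ys) xs ≡ cartesianProductWith g xs ys
concatMap≡cartesianProductWith g []       ys = refl
concatMap≡cartesianProductWith g (x ∷ xs) ys = cong (map (g x) ys ++_) (concatMap≡cartesianProductWith g xs ys)

∏-* : (xs : List X) (f g : X → ℚ) → ∏ xs (λ x → f x * g x) ≡ ∏ xs f * ∏ xs g
∏-* []       f g = refl
∏-* (x ∷ xs) f g = trans (cong (f x * g x *_) (∏-* xs f g)) (*-interchange (f x) (g x) _ _)

∏-one : (xs : List X) → ∏ xs (λ _ → 1ℚ) ≡ 1ℚ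
∏-one []       = refl
∏-one (x ∷ xs) = trans (ℚ.*-identityˡ _) (∏-one xs)

∏-++ : (xs ys : List X) (f : X → ℚ) → ∏ (xs ++ ys) f ≡ ∏ xs f * ∏ ys f
∏-++ []       ys f = sym (ℚ.*-identityˡ _)
∏-++ (x ∷ xs) ys f = trans (cong (f x *_) (∏-++ xs ys f)) (sym (ℚ.*-assoc (f x) _ _))

∏-map : (g : X → Y) (xs : List X) (f : Y → ℚ) → ∏ (map g xs) f ≡ ∏ xs (λ x → f (g x))
∏-map g []       f = refl
∏-map g (x ∷ xs) f = cong (f (g x) *_) (∏-map g xs f)

∏-bits : ∀ n (f : Subset (suc n) → ℚ) →
  ∏ (bits (suc n)) f ≡ ∏ (bits n) (λ B → f (false ∷ B)) * ∏ (bits n) (λ B → f (true ∷ B))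
∏-bits n f = trans (∏-++ (map (false ∷_) (bits n)) _ f) (cong₂ _*_ (∏-map _ (bits n) f)
  (trans (∏-++ (map (true ∷_) (bits n)) [] f) (trans (ℚ.*-identityʳ _) (∏-map _ (bits n) f))))

-- Averages over the group and its powers.

module Averages (G : FiniteAbelianGroup) where
  open FiniteAbelianGroup G using (finite; size; sum; 0#; isAbelianGroup) renaming (Carrier to V; _+_ to _⊕_; -_ to ⊖_) public

  abelianGroup : AbelianGroup _ _
  abelianGroup = record { isAbelianGroup = isAbelianGroup }

  open AbelianGroup abelianGroup public using () renaming (assoc to ⊕-assoc; comm to ⊕-comm; identityˡ to ⊕-identityˡ; identityʳ to ⊕-identityʳ; inverseˡ to ⊕-inverseˡ; inverseʳ to ⊕-inverseʳ)

  points : List V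
  points = elements finite

  opaque
    E : (V → ℚ) → ℚ
    E = 𝔼 points

    Eᵛ : (Vec V n → ℚ) → ℚ
    Eᵛ {n} = 𝔼 (vectors points n)

  length-points : length points ≡ size
  length-points = trans (List.length-map (Inverse.from finite) (allFin size)) (List.length-tabulate {n = size} (λ i → i))

  points-normalised : Normalised points
  points-normalised = nonempty⇒normalised points {{subst ℕ.NonZero (sym length-points) (FiniteAbelianGroup.size-nonZero G)}}

  opaque
    unfolding E Eᵛ

    mutual
      vectors-normalised : ∀ n → Normalised (vectors points n)
      vectors-normalised zero    = normalised refl
      vectors-normalised (suc n) = normalised
        (trans (Eᵛ-∷ (λ _ → 1ℚ)) (trans (𝔼-cong points λ _ → Normalised.total (vectors-normalised n)) (Normalised.total points-normalised)))

      Eᵛ-∷ : (F : Vec V (suc n) → ℚ) → Eᵛ F ≡ E λ x → Eᵛ λ v → F (x ∷ v)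
      Eᵛ-∷ {n} F = trans (cong (λ vs → 𝔼 vs F) (concatMap≡cartesianProductWith _∷_ points (vectors points n)))
        (𝔼-cartesianProductWith points-normalised (vectors-normalised n) _∷_ F)

    Eᵛ≡𝔼 : (F : Vec V n → ℚ) → Eᵛ F ≡ 𝔼 (vectors points n) F
    Eᵛ≡𝔼 F = refl

    Eᵛ-[] : (F : Vec V 0 → ℚ) → Eᵛ F ≡ F []
    Eᵛ-[] F = trans (ℚ.*-identityʳ _) (ℚ.+-identityʳ (F []))

    Eᵛ-cong : {F H : Vec V n → ℚ} → (∀ x → F x ≡ H x) → Eᵛ F ≡ Eᵛ H
    Eᵛ-cong {n} = 𝔼-cong (vectors points n)

    E-cong : {f g : V → ℚ} → (∀ x → f x ≡ g x) → E f ≡ E g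
    E-cong = 𝔼-cong points

    -- The enumeration of the group turns `π` into a permutation of `Fin size`, under which finite
    -- sums are invariant.
    E-permute : (π : V ↔ V) (f : V → ℚ) → E (λ x → f (Inverse.to π x)) ≡ E f
    E-permute π f = trans (𝔼≡∑*recip points _) (trans (cong (_* recip (length points)) (begin
        ∑ points (λ x → f (Inverse.to π x))                            ≡⟨ ∑-points _ ⟩
        S.sum (λ i → f (Inverse.to π (Inverse.from finite i)))         ≡⟨ S.sum-cong-≗ {size} (λ i → cong f (Inverse.strictlyInverseʳ finite (Inverse.to π (Inverse.from finite i)))) ⟨
        S.sum (λ i → f (Inverse.from finite (Inverse.to σ i)))         ≡⟨ S.sum-permute (λ i → f (Inverse.from finite i)) σ ⟨
        S.sum (λ i → f (Inverse.from finite i))                        ≡⟨ ∑-points f ⟨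
        ∑ points f                                                     ∎)) (sym (𝔼≡∑*recip points f)))
      where
      open ≡-Reasoning
      module S = Algebra.Properties.CommutativeMonoid.Sum ℚ.+-0-commutativeMonoid
      σ : Fin size ↔ Fin size
      σ = finite ↔-∘ (π ↔-∘ ↔-sym finite)
      ∑-tabulate : ∀ {m} (g : Fin m → V) (f : V → ℚ) → ∑ (tabulate g) f ≡ S.sum (λ i → f (g i))
      ∑-tabulate {zero}  g f = refl
      ∑-tabulate {suc m} g f = cong (f (g Fin.zero) +_) (∑-tabulate (λ i → g (Fin.suc i)) f)
      ∑-points : ∀ f → ∑ points f ≡ S.sum (λ i → f (Inverse.from finite i))
      ∑-points f = trans (cong (λ xs → ∑ xs f) (List.map-tabulate (λ i → i) (Inverse.from finite))) (∑-tabulate (Inverse.from finite) f)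

    E-Eᵛ-swap : (F : V → Vec V n → ℚ) → E (λ x → Eᵛ (F x)) ≡ Eᵛ (λ v → E (λ x → F x v))
    E-Eᵛ-swap {n} = 𝔼-swap points (vectors points n)

    E-swap : (F : V → V → ℚ) → E (λ x → E (F x)) ≡ E (λ y → E (λ x → F x y))
    E-swap = 𝔼-swap points points

    E-*ˡ : ∀ c (f : V → ℚ) → E (λ x → c * f x) ≡ c * E f
    E-*ˡ = 𝔼-*ˡ points

    E-*ʳ : ∀ c (f : V → ℚ) → E (λ x → f x * c) ≡ E f * c
    E-*ʳ = 𝔼-*ʳ points

    E-^2^ : ∀ m (f : V → ℚ) → E f ^2^ m ℚ.≤ E (λ x → f x ^2^ m)
    E-^2^ = 𝔼-^2^ points-normalised

    E-mono : {f g : V → ℚ} → (∀ x → f x ℚ.≤ g x) → E f ℚ.≤ E g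
    E-mono = 𝔼-mono points

    E-const : ∀ c → E (λ _ → c) ≡ c
    E-const = 𝔼-const points-normalised

    E-sq : (f : V → ℚ) → E f * E f ℚ.≤ E (λ x → f x * f x)
    E-sq = 𝔼-sq points-normalised

    E-≤ : ∀ {c} {f : V → ℚ} → (∀ x → f x ℚ.≤ c) → E f ℚ.≤ c
    E-≤ = 𝔼-≤ points-normalised

    Eᵛ-mono : {F H : Vec V n → ℚ} → (∀ x → F x ℚ.≤ H x) → Eᵛ F ℚ.≤ Eᵛ H
    Eᵛ-mono {n} = 𝔼-mono (vectors points n)

    Eᵛ-+ : (F H : Vec V n → ℚ) → Eᵛ (λ x → F x + H x) ≡ Eᵛ F + Eᵛ H
    Eᵛ-+ {n} = 𝔼-+ (vectors points n)

    Eᵛ-*ˡ : ∀ c (F : Vec V n → ℚ) → Eᵛ (λ x → c * F x) ≡ c * Eᵛ F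
    Eᵛ-*ˡ {n} = 𝔼-*ˡ (vectors points n)

    Eᵛ-∣∣ : (F : Vec V n → ℚ) → ℚ.∣ Eᵛ F ∣ ℚ.≤ Eᵛ (λ x → ℚ.∣ F x ∣)
    Eᵛ-∣∣ {n} = 𝔼-∣∣ (vectors points n)

    Eᵛ-≤ : ∀ {c} {F : Vec V n → ℚ} → (∀ x → F x ℚ.≤ c) → Eᵛ F ℚ.≤ c
    Eᵛ-≤ {n} = 𝔼-≤ (vectors-normalised n)

    gowersAverage≡ : ∀ m (F : V → ℚ) → gowersAverage G m F ≡ Eᵛ λ h → E λ x → ∏ (bits m) λ ω → F (x ⊕ dot G ω h)
    gowersAverage≡ m F = trans (𝔼-cartesianProductWith points-normalised (vectors-normalised m) _,_ _) (E-Eᵛ-swap {m} _)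

    Eᵛ-sq-*-≤ : (u g : Vec V n → ℚ) → (∀ x → u x * u x ℚ.≤ 1ℚ) →
      Eᵛ (λ x → u x * g x) * Eᵛ (λ x → u x * g x) ℚ.≤ Eᵛ (λ x → g x * g x)
    Eᵛ-sq-*-≤ {n} = 𝔼-sq-*-≤ (vectors-normalised n)

  ⊕-⊖ : ∀ x a → (x ⊕ a) ⊕ ⊖ a ≡ x
  ⊕-⊖ x a = trans (⊕-assoc x a (⊖ a)) (trans (cong (x ⊕_) (⊕-inverseʳ a)) (⊕-identityʳ x))

  ⊖-⊕ : ∀ x a → (x ⊕ ⊖ a) ⊕ a ≡ x
  ⊖-⊕ x a = trans (⊕-assoc x (⊖ a) a) (trans (cong (x ⊕_) (⊕-inverseˡ a)) (⊕-identityʳ x))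

  E-shift : ∀ a (f : V → ℚ) → E (λ x → f (x ⊕ a)) ≡ E f
  E-shift a = E-permute (mk↔ₛ′ (_⊕ a) (_⊕ ⊖ a) (λ x → ⊖-⊕ x a) (λ x → ⊕-⊖ x a))

  E-shiftˡ : ∀ a (f : V → ℚ) → E (λ x → f (a ⊕ x)) ≡ E f
  E-shiftˡ a f = trans (E-cong λ x → cong f (⊕-comm a x)) (E-shift a f)

  infixl 6 _⊕ᵛ_

  _⊕ᵛ_ : Vec V n → Vec V n → Vec V n
  _⊕ᵛ_ = zipWith _⊕_

  Eᵛ-shift : (t : Vec V n) (F : Vec V n → ℚ) → Eᵛ (λ x → F (x ⊕ᵛ t)) ≡ Eᵛ F
  Eᵛ-shift []      F = Eᵛ-cong {H = F} λ { [] → refl }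
  Eᵛ-shift (a ∷ t) F = begin
    Eᵛ (λ x → F (x ⊕ᵛ (a ∷ t)))                          ≡⟨ Eᵛ-∷ _ ⟩
    E (λ x → Eᵛ λ v → F ((x ⊕ a) ∷ (v ⊕ᵛ t)))            ≡⟨ E-cong (λ x → Eᵛ-shift t (λ v → F ((x ⊕ a) ∷ v))) ⟩
    E (λ x → Eᵛ λ v → F ((x ⊕ a) ∷ v))                   ≡⟨ E-shift a (λ x → Eᵛ λ v → F (x ∷ v)) ⟩
    E (λ x → Eᵛ λ v → F (x ∷ v))                         ≡⟨ Eᵛ-∷ F ⟨
    Eᵛ F                                                 ∎
    where open ≡-Reasoning

  ⊕-interchange : ∀ a b c d → (a ⊕ b) ⊕ (c ⊕ d) ≡ (a ⊕ c) ⊕ (b ⊕ d)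
  ⊕-interchange a b c d = trans (⊕-assoc a b _) (trans (cong (a ⊕_) (trans (sym (⊕-assoc b c d)) (trans (cong (_⊕ d) (⊕-comm b c)) (⊕-assoc c b d)))) (sym (⊕-assoc a c _)))

  sum-⊕ᵛ : (x t : Vec V n) → sum (x ⊕ᵛ t) ≡ sum x ⊕ sum t
  sum-⊕ᵛ []      []      = sym (⊕-identityˡ 0#)
  sum-⊕ᵛ (x ∷ v) (a ∷ t) = trans (cong ((x ⊕ a) ⊕_) (sum-⊕ᵛ v t)) (⊕-interchange x a (sum v) (sum t))

  E-E-* : (f g : V → ℚ) → E f * E g ≡ E (λ x → E (λ y → f x * g y))
  E-E-* f g = trans (sym (E-*ʳ (E g) f)) (E-cong λ x → sym (E-*ˡ (f x) g))

  -- Bounded functions and dependence on coordinates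

  record Bounded {X : Set} (u : X → ℚ) : Set where
    constructor bounded
    field bound : ∀ x → u x * u x ℚ.≤ 1ℚ

  open Bounded public

  Bounded-1 : {X : Set} → Bounded {X} (λ _ → 1ℚ)
  Bounded-1 = bounded λ _ → ℚ.≤-refl

  Bounded-∘ : {X Y : Set} {u : Y → ℚ} → Bounded u → (g : X → Y) → Bounded (λ x → u (g x))
  Bounded-∘ bu g = bounded λ x → bound bu (g x)

  Bounded-* : {X : Set} {u v : X → ℚ} → Bounded u → Bounded v → Bounded (λ x → u x * v x)
  Bounded-* {u = u} {v} bu bv = bounded λ x → ℚ.≤-trans (ℚ.≤-reflexive (*-sq (u x) (v x)))
    (*-mono (0≤p*p (u x)) 0≤1 (bound bu x) (bound bv x))

  Bounded-E : {X : Set} {u : V → X → ℚ} → (∀ y → Bounded (u y)) → Bounded (λ x → E (λ y → u y x))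
  Bounded-E {u = u} bu = bounded λ x → ℚ.≤-trans (E-sq (λ y → u y x)) (E-≤ λ y → bound (bu y) x)

  Bounded-∏ : {X Y : Set} (ys : List Y) {u : Y → X → ℚ} → (∀ y → Bounded (u y)) → Bounded (λ x → ∏ ys (λ y → u y x))
  Bounded-∏ []       bu = Bounded-1
  Bounded-∏ (y ∷ ys) bu = Bounded-* (bu y) (Bounded-∏ ys bu)

  -- Functions of the coordinates in B are kept as functions on all of V^n, so that those for
  -- different B multiply without reindexing.
  record DependsOn (B : Subset n) (u : Vec V n → ℚ) : Set where
    constructor dependsOn
    field depends : ∀ x y → restrict x B ≡ restrict y B → u x ≡ u y

  open DependsOn public

  DependsOn-∷ : ∀ {b} {B : Subset n} {u : Vec V (suc n) → ℚ} → DependsOn (b ∷ B) u → ∀ x → DependsOn B (λ v → u (x ∷ v))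
  DependsOn-∷ {b = true}  du x = dependsOn λ v w eq → depends du (x ∷ v) (x ∷ w) (cong (x ∷_) eq)
  DependsOn-∷ {b = false} du x = dependsOn λ v w eq → depends du (x ∷ v) (x ∷ w) eq

  DependsOn-* : {B : Subset n} {u v : Vec V n → ℚ} → DependsOn B u → DependsOn B v → DependsOn B (λ x → u x * v x)
  DependsOn-* du dv = dependsOn λ x y eq → cong₂ _*_ (depends du x y eq) (depends dv x y eq)

  DependsOn-1 : {B : Subset n} → DependsOn B (λ _ → 1ℚ)
  DependsOn-1 = dependsOn λ _ _ _ → refl

  restrict-⊕ᵛ : (x t : Vec V n) (B : Subset n) → restrict (x ⊕ᵛ t) B ≡ restrict x B ⊕ᵛ restrict t B
  restrict-⊕ᵛ []      []      []          = refl
  restrict-⊕ᵛ (x ∷ v) (a ∷ t) (true ∷ B)  = cong ((x ⊕ a) ∷_) (restrict-⊕ᵛ v t B)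
  restrict-⊕ᵛ (x ∷ v) (a ∷ t) (false ∷ B) = restrict-⊕ᵛ v t B

  DependsOn-shift : {B : Subset n} {u : Vec V n → ℚ} (t : Vec V n) → DependsOn B u → DependsOn B (λ x → u (x ⊕ᵛ t))
  DependsOn-shift {B = B} t du = dependsOn λ x y eq → depends du (x ⊕ᵛ t) (y ⊕ᵛ t) (trans (restrict-⊕ᵛ x t B) (trans (cong (_⊕ᵛ restrict t B) eq) (sym (restrict-⊕ᵛ y t B))))

  -- B is not contained in C.
  data Escapes : Subset n → Subset n → Set where
    here  : {B C : Subset n} → Escapes (true ∷ B) (false ∷ C)
    there : ∀ {b c} {B C : Subset n} → Escapes B C → Escapes (b ∷ B) (c ∷ C)

  -- Pigeonhole. In part (i) this makes every set of d coordinates omit one of d + 1 given ones.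
  <⇒Escapes : (B C : Subset n) → ∣ C ∣ ℕ.< ∣ B ∣ → Escapes B C
  <⇒Escapes (true ∷ B)  (false ∷ C) lt = here
  <⇒Escapes (true ∷ B)  (true ∷ C)  lt = there (<⇒Escapes B C (ℕ.s<s⁻¹ lt))
  <⇒Escapes (false ∷ B) (true ∷ C)  lt = there (<⇒Escapes B C (ℕ.<-trans (ℕ.n<1+n _) lt))
  <⇒Escapes (false ∷ B) (false ∷ C) lt = there (<⇒Escapes B C lt)

  -- Distinct sets of equal size do not contain each other. In part (ii) it shows that every weight
  -- other than the one at B ignores a coordinate of B.
  ≢⇒Escapes : (B C : Subset n) → ∣ C ∣ ≡ ∣ B ∣ → C ≢ B → Escapes B C
  ≢⇒Escapes []          []          eq C≢B = contradiction refl C≢B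
  ≢⇒Escapes (true ∷ B)  (false ∷ C) eq C≢B = here
  ≢⇒Escapes (true ∷ B)  (true ∷ C)  eq C≢B = there (≢⇒Escapes B C (ℕ.suc-injective eq) λ C≡B → C≢B (cong (true ∷_) C≡B))
  -- The rest of C is now strictly smaller than the rest of B.
  ≢⇒Escapes (false ∷ B) (true ∷ C)  eq C≢B = there (<⇒Escapes B C (subst (∣ C ∣ ℕ.<_) eq (ℕ.n<1+n _)))
  ≢⇒Escapes (false ∷ B) (false ∷ C) eq C≢B = there (≢⇒Escapes B C eq λ C≡B → C≢B (cong (false ∷_) C≡B))

  -- Box averages (powers of Gowers box norms in the coordinates of B, averaged over the other
  -- coordinates) and their dual functions.

  Box : Subset n → (Vec V n → ℚ) → ℚ
  Box []          F = F []
  Box (true ∷ B)  F = E λ x → E λ y → Box B (λ v → F (x ∷ v) * F (y ∷ v))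
  Box (false ∷ B) F = E λ x → Box B (λ v → F (x ∷ v))

  Box-cong : (B : Subset n) {F H : Vec V n → ℚ} → (∀ x → F x ≡ H x) → Box B F ≡ Box B H
  Box-cong []          eq = eq []
  Box-cong (true ∷ B)  eq = E-cong λ x → E-cong λ y → Box-cong B λ v → cong₂ _*_ (eq (x ∷ v)) (eq (y ∷ v))
  Box-cong (false ∷ B) eq = E-cong λ x → Box-cong B λ v → eq (x ∷ v)

  -- P is a product of bounded functions each of which ignores some
  -- coordinate in B.
  data Missing : Subset n → (Vec V n → ℚ) → Set where
    nil  : {P : Vec V 0 → ℚ} → P [] ≡ 1ℚ → Missing [] P
    keep : {B : Subset n} {P : Vec V (suc n) → ℚ} (u : Vec V n → ℚ) (Q : V → Vec V n → ℚ) →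
           Bounded u → (∀ x → Missing B (Q x)) → (∀ x v → P (x ∷ v) ≡ u v * Q x v) → Missing (true ∷ B) P
    skip : {B : Subset n} {P : Vec V (suc n) → ℚ} → (∀ x → Missing B (λ v → P (x ∷ v))) → Missing (false ∷ B) P

  Missing-1 : (B : Subset n) → Missing B (λ _ → 1ℚ)
  Missing-1 []          = nil refl
  Missing-1 (true ∷ B)  = keep (λ _ → 1ℚ) (λ _ _ → 1ℚ) Bounded-1 (λ _ → Missing-1 B) λ _ _ → refl
  Missing-1 (false ∷ B) = skip λ _ → Missing-1 B

  Missing-* : {B : Subset n} {P Q : Vec V n → ℚ} → Missing B P → Missing B Q → Missing B (λ x → P x * Q x)
  Missing-* (nil eqP) (nil eqQ) = nil (cong₂ _*_ eqP eqQ)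
  Missing-* (keep u P′ bu mP eqP) (keep w Q′ bw mQ eqQ) =
    keep (λ v → u v * w v) (λ x v → P′ x v * Q′ x v) (Bounded-* bu bw) (λ x → Missing-* (mP x) (mQ x))
    λ x v → trans (cong₂ _*_ (eqP x v) (eqQ x v)) (*-interchange (u v) (P′ x v) (w v) (Q′ x v))
  Missing-* (skip mP) (skip mQ) = skip λ x → Missing-* (mP x) (mQ x)

  Missing-∏ : {Y : Set} (B : Subset n) (ys : List Y) {u : Y → Vec V n → ℚ} → (∀ {y} → y ∈ ys → Missing B (u y)) →
    Missing B (λ x → ∏ ys (λ y → u y x))
  Missing-∏ B []       m = Missing-1 B
  Missing-∏ B (y ∷ ys) m = Missing-* (m (here refl)) (Missing-∏ B ys λ y∈ → m (there y∈))

  Missing-cong : {B : Subset n} {P Q : Vec V n → ℚ} → (∀ x → P x ≡ Q x) → Missing B P → Missing B Q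
  Missing-cong eq (nil eqP) = nil (trans (sym (eq [])) eqP)
  Missing-cong eq (keep u P′ bu mP eqP) = keep u P′ bu mP λ x v → trans (sym (eq (x ∷ v))) (eqP x v)
  Missing-cong eq (skip mP) = skip λ x → Missing-cong (λ v → eq (x ∷ v)) (mP x)

  -- At the first coordinate found in B but not in C, the whole function serves as the factor `u` of
  -- `keep`, with that coordinate frozen at `0#`; all other factors are 1.
  Escapes⇒Missing : {B C : Subset n} {u : Vec V n → ℚ} → Escapes B C → Bounded u → DependsOn C u → Missing B u
  Escapes⇒Missing {B = true ∷ B} {u = u} here bu du =
    keep (λ v → u (0# ∷ v)) (λ _ _ → 1ℚ) (Bounded-∘ bu (0# ∷_)) (λ _ → Missing-1 B)
    λ x v → trans (depends du (x ∷ v) (0# ∷ v) refl) (sym (ℚ.*-identityʳ _))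
  Escapes⇒Missing {B = true ∷ B} {u = u} (there esc) bu du =
    keep (λ _ → 1ℚ) (λ x v → u (x ∷ v)) Bounded-1 (λ x → Escapes⇒Missing esc (Bounded-∘ bu (x ∷_)) (DependsOn-∷ du x))
    λ x v → sym (ℚ.*-identityˡ _)
  Escapes⇒Missing {B = false ∷ B} (there esc) bu du = skip λ x → Escapes⇒Missing esc (Bounded-∘ bu (x ∷_)) (DependsOn-∷ du x)

  -- One Cauchy-Schwarz per coordinate in B: the factor `u` ignores that coordinate, so it leaves
  -- the inner average and is discarded, and squaring what remains doubles the coordinate. The
  -- surviving product `Q x * Q y` still has the missing property for the later coordinates.
  box-cauchySchwarz : (B : Subset n) (F : Vec V n → ℚ) {P : Vec V n → ℚ} → Missing B P →
    Eᵛ (λ x → F x * P x) ^2^ ∣ B ∣ ℚ.≤ Box B F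
  box-cauchySchwarz [] F {P} (nil mP) = ℚ.≤-reflexive (trans (Eᵛ-[] _) (trans (cong (F [] *_) mP) (ℚ.*-identityʳ _)))
  box-cauchySchwarz {suc n} (true ∷ B) F {P} (keep u Q bu mQ eq) = begin
      (e * e) ^2^ ∣ B ∣
        ≤⟨ ^2^-mono ∣ B ∣ (0≤p*p e) (begin
          e * e
            ≡⟨ cong (λ e → e * e) e≡ ⟩
          Eᵛ (λ v → u v * g v) * Eᵛ (λ v → u v * g v)
            ≤⟨ Eᵛ-sq-*-≤ u g (bound bu) ⟩
          Eᵛ (λ v → g v * g v)
            ≡⟨ g²≡ ⟩
          E (λ x → E λ y → Eᵛ (λ v → F₂ x y v * (Q x v * Q y v))) ∎) ⟩
      E (λ x → E λ y → Eᵛ (λ v → F₂ x y v * (Q x v * Q y v))) ^2^ ∣ B ∣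
        -- Convexity moves the remaining squarings inside the averages over x and y, where the
        -- induction hypothesis applies to each `F₂ x y`.
        ≤⟨ E-^2^ ∣ B ∣ _ ⟩
      E (λ x → E (λ y → Eᵛ (λ v → F₂ x y v * (Q x v * Q y v))) ^2^ ∣ B ∣)
        ≤⟨ E-mono (λ x → E-^2^ ∣ B ∣ _) ⟩
      E (λ x → E (λ y → Eᵛ (λ v → F₂ x y v * (Q x v * Q y v)) ^2^ ∣ B ∣))
        ≤⟨ E-mono (λ x → E-mono (λ y → box-cauchySchwarz B (F₂ x y) (Missing-* (mQ x) (mQ y)))) ⟩
      Box (true ∷ B) F ∎
    where
    open ℚ.≤-Reasoning
    e = Eᵛ (λ x → F x * P x)
    g : Vec V n → ℚ
    g v = E λ x → F (x ∷ v) * Q x v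
    F₂ : V → V → Vec V n → ℚ
    F₂ x y v = F (x ∷ v) * F (y ∷ v)
    e≡ : e ≡ Eᵛ (λ v → u v * g v)
    e≡ = trans (Eᵛ-∷ _) (trans (E-Eᵛ-swap _) (Eᵛ-cong λ v →
      trans (E-cong λ x → trans (cong (F (x ∷ v) *_) (eq x v)) (*-leftComm (F (x ∷ v)) (u v) (Q x v))) (E-*ˡ (u v) _)))
    g²≡ : Eᵛ (λ v → g v * g v) ≡ E (λ x → E λ y → Eᵛ (λ v → F₂ x y v * (Q x v * Q y v)))
    g²≡ = sym (trans (E-cong λ x → E-Eᵛ-swap _) (trans (E-Eᵛ-swap _) (Eᵛ-cong λ v →
      sym (trans (E-E-* _ _) (E-cong λ x → E-cong λ y → *-interchange (F (x ∷ v)) (Q x v) (F (y ∷ v)) (Q y v))))))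
  box-cauchySchwarz (false ∷ B) F {P} (skip mP) = begin
      Eᵛ (λ x → F x * P x) ^2^ ∣ B ∣                                 ≡⟨ cong (_^2^ ∣ B ∣) (Eᵛ-∷ _) ⟩
      E (λ x → Eᵛ (λ v → F (x ∷ v) * P (x ∷ v))) ^2^ ∣ B ∣           ≤⟨ E-^2^ ∣ B ∣ _ ⟩
      E (λ x → Eᵛ (λ v → F (x ∷ v) * P (x ∷ v)) ^2^ ∣ B ∣)           ≤⟨ E-mono (λ x → box-cauchySchwarz B _ (mP x)) ⟩
      Box (false ∷ B) F ∎
    where open ℚ.≤-Reasoning

  -- The dual function: the product of F over all vertices of the box except v itself, averaged over
  -- the second copies of the coordinates in B.
  boxDual : Subset n → (Vec V n → ℚ) → Vec V n → ℚ
  boxDual []          F v       = 1ℚ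
  boxDual (true ∷ B)  F (x ∷ v) = E λ y → F (y ∷ v) * boxDual B (λ w → F (x ∷ w) * F (y ∷ w)) v
  boxDual (false ∷ B) F (x ∷ v) = boxDual B (λ w → F (x ∷ w)) v

  Box≡⟨F,boxDual⟩ : (B : Subset n) (F : Vec V n → ℚ) → Box B F ≡ Eᵛ (λ x → F x * boxDual B F x)
  Box≡⟨F,boxDual⟩ [] F = sym (trans (Eᵛ-[] _) (ℚ.*-identityʳ (F [])))
  Box≡⟨F,boxDual⟩ (true ∷ B) F = sym (trans (Eᵛ-∷ _) (E-cong λ x → begin
      Eᵛ (λ v → F (x ∷ v) * E (λ y → F (y ∷ v) * boxDual B (F₂ x y) v))
        ≡⟨ Eᵛ-cong (λ v → trans (sym (E-*ˡ (F (x ∷ v)) _)) (E-cong λ y → sym (ℚ.*-assoc (F (x ∷ v)) _ _))) ⟩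
      Eᵛ (λ v → E (λ y → F₂ x y v * boxDual B (F₂ x y) v))
        ≡⟨ E-Eᵛ-swap _ ⟨
      E (λ y → Eᵛ (λ v → F₂ x y v * boxDual B (F₂ x y) v))
        ≡⟨ E-cong (λ y → Box≡⟨F,boxDual⟩ B (F₂ x y)) ⟨
      E (λ y → Box B (F₂ x y)) ∎))
    where
    open ≡-Reasoning
    F₂ : V → V → Vec V _ → ℚ
    F₂ x y v = F (x ∷ v) * F (y ∷ v)
  Box≡⟨F,boxDual⟩ (false ∷ B) F = sym (trans (Eᵛ-∷ _) (E-cong λ x → sym (Box≡⟨F,boxDual⟩ B _)))

  boxDual-cong : (B : Subset n) {F H : Vec V n → ℚ} → (∀ x → F x ≡ H x) → ∀ v → boxDual B F v ≡ boxDual B H v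
  boxDual-cong []          eq v       = refl
  boxDual-cong (true ∷ B)  eq (x ∷ v) = E-cong λ y → cong₂ _*_ (eq (y ∷ v)) (boxDual-cong B (λ w → cong₂ _*_ (eq (x ∷ w)) (eq (y ∷ w))) v)
  boxDual-cong (false ∷ B) eq (x ∷ v) = boxDual-cong B (λ w → eq (x ∷ w)) v

  boxDual-bounded : (B : Subset n) {F : Vec V n → ℚ} → Bounded F → Bounded (boxDual B F)
  boxDual-bounded []          bF = bounded λ _ → ℚ.≤-refl
  boxDual-bounded (true ∷ B)  bF = bounded λ { (x ∷ v) → bound (Bounded-E λ y → Bounded-* (Bounded-∘ bF (y ∷_))
    (boxDual-bounded B (Bounded-* (Bounded-∘ bF (x ∷_)) (Bounded-∘ bF (y ∷_))))) v }
  boxDual-bounded (false ∷ B) bF = bounded λ { (x ∷ v) → bound (boxDual-bounded B (Bounded-∘ bF (x ∷_))) v }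

  boxDual-dependsOn : (B : Subset n) {F : Vec V n → ℚ} → DependsOn B F → DependsOn B (boxDual B F)
  boxDual-dependsOn []          dF = dependsOn λ _ _ _ → refl
  boxDual-dependsOn (true ∷ B)  {F} dF = dependsOn λ { (x ∷ v) (x′ ∷ v′) eq → step x x′ v v′ (Vec.∷-injective eq) }
    where
    step : ∀ x x′ v v′ → x ≡ x′ × restrict v B ≡ restrict v′ B → boxDual (true ∷ B) F (x ∷ v) ≡ boxDual (true ∷ B) F (x′ ∷ v′)
    step x _ v v′ (refl , eq) = E-cong λ y → cong₂ _*_ (depends (DependsOn-∷ dF y) v v′ eq)
      (depends (boxDual-dependsOn B (DependsOn-* (DependsOn-∷ dF x) (DependsOn-∷ dF y))) v v′ eq)
  boxDual-dependsOn (false ∷ B) {F} dF = dependsOn λ { (x ∷ v) (x′ ∷ v′) eq →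
    trans (depends (boxDual-dependsOn B (DependsOn-∷ dF x)) v v′ eq) (boxDual-cong B (λ w → depends dF (x ∷ w) (x′ ∷ w) refl) v′) }

  -- Conditional expectation onto a set of coordinates.

  condExp : Subset n → (Vec V n → ℚ) → Vec V n → ℚ
  condExp []          F v       = F []
  condExp (true ∷ B)  F (x ∷ v) = condExp B (λ w → F (x ∷ w)) v
  condExp (false ∷ B) F (_ ∷ v) = E λ x → condExp B (λ w → F (x ∷ w)) v

  condExp-bounded : (B : Subset n) {F : Vec V n → ℚ} → Bounded F → Bounded (condExp B F)
  condExp-bounded []          bF = bounded λ _ → bound bF []
  condExp-bounded (true ∷ B)  bF = bounded λ { (x ∷ v) → bound (condExp-bounded B (Bounded-∘ bF (x ∷_))) v }
  condExp-bounded (false ∷ B) bF = bounded λ { (_ ∷ v) → bound (Bounded-E λ x → condExp-bounded B (Bounded-∘ bF (x ∷_))) v }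

  condExp-dependsOn : (B : Subset n) (F : Vec V n → ℚ) → DependsOn B (condExp B F)
  condExp-dependsOn []          F = dependsOn λ _ _ _ → refl
  condExp-dependsOn (true ∷ B)  F = dependsOn λ { (x ∷ v) (x′ ∷ v′) eq → step x x′ v v′ (Vec.∷-injective eq) }
    where
    step : ∀ x x′ v v′ → x ≡ x′ × restrict v B ≡ restrict v′ B → condExp B (λ w → F (x ∷ w)) v ≡ condExp B (λ w → F (x′ ∷ w)) v′
    step x _ v v′ (refl , eq) = depends (condExp-dependsOn B (λ w → F (x ∷ w))) v v′ eq
  condExp-dependsOn (false ∷ B) F = dependsOn λ { (_ ∷ v) (_ ∷ v′) eq →
    E-cong λ x → depends (condExp-dependsOn B (λ w → F (x ∷ w))) v v′ eq }

  Eᵛ-condExp : (B : Subset n) (F : Vec V n → ℚ) {u : Vec V n → ℚ} → DependsOn B u → Eᵛ (λ x → u x * F x) ≡ Eᵛ (λ x → u x * condExp B F x)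
  Eᵛ-condExp [] F {u} du = Eᵛ-cong {H = λ x → u x * condExp [] F x} λ { [] → refl }
  Eᵛ-condExp (true ∷ B) F {u} du = trans (Eᵛ-∷ _) (trans (E-cong λ x → Eᵛ-condExp B _ {λ v → u (x ∷ v)} (DependsOn-∷ du x)) (sym (Eᵛ-∷ _)))
  Eᵛ-condExp (false ∷ B) F {u} du = begin
      Eᵛ (λ x → u x * F x)
        ≡⟨ Eᵛ-∷ _ ⟩
      E (λ x → Eᵛ λ v → u (x ∷ v) * F (x ∷ v))
        ≡⟨ E-cong (λ x → Eᵛ-condExp B _ {λ v → u (x ∷ v)} (DependsOn-∷ du x)) ⟩
      E (λ x → Eᵛ λ v → u (x ∷ v) * C x v)
        -- As `u` ignores the first coordinate, it is frozen at `0#` while the average over x passes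
        -- inside, and is unfrozen afterwards.
        ≡⟨ E-cong (λ x → Eᵛ-cong λ v → cong (_* C x v) (depends du (x ∷ v) (0# ∷ v) refl)) ⟩
      E (λ x → Eᵛ λ v → u (0# ∷ v) * C x v)
        ≡⟨ E-Eᵛ-swap _ ⟩
      Eᵛ (λ v → E λ x → u (0# ∷ v) * C x v)
        ≡⟨ Eᵛ-cong (λ v → E-*ˡ (u (0# ∷ v)) _) ⟩
      Eᵛ (λ v → u (0# ∷ v) * E (λ x → C x v))
        ≡⟨ E-const _ ⟨
      E (λ x → Eᵛ λ v → u (0# ∷ v) * E (λ x → C x v))
        ≡⟨ E-cong (λ x → Eᵛ-cong λ v → cong (_* E (λ x → C x v)) (depends du (0# ∷ v) (x ∷ v) refl)) ⟩
      E (λ x → Eᵛ λ v → u (x ∷ v) * E (λ x → C x v))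
        ≡⟨ Eᵛ-∷ _ ⟨
      Eᵛ (λ x → u x * condExp (false ∷ B) F x) ∎
    where
    open ≡-Reasoning
    C : V → Vec V _ → ℚ
    C x = condExp B (λ w → F (x ∷ w))

infix 4 _≟ˢ_

_≟ˢ_ : DecidableEquality (Subset n)
_≟ˢ_ = Vec.≡-dec Bool._≟_

∏-bits-δ : (B : Subset n) (c : ℚ) → ∏ (bits n) (λ C → if does (C ≟ˢ B) then c else 1ℚ) ≡ c
∏-bits-δ []      c = ℚ.*-identityʳ c
∏-bits-δ {suc n} (true ∷ B) c = trans (∏-bits n (λ C → if does (C ≟ˢ true ∷ B) then c else 1ℚ))
  (trans (cong₂ _*_ (∏-one (bits n)) (∏-bits-δ B c)) (ℚ.*-identityˡ c))
∏-bits-δ {suc n} (false ∷ B) c = trans (∏-bits n (λ C → if does (C ≟ˢ false ∷ B) then c else 1ℚ))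
  (trans (cong₂ _*_ (∏-bits-δ B c) (∏-one (bits n))) (ℚ.*-identityʳ c))

bits-complete : (B : Subset n) → B ∈ bits n
bits-complete = vectors-complete λ { false → here refl ; true → there (here refl) }

-- Products and averages of functions of few coordinates.

module Structured (G : FiniteAbelianGroup) where
  open Averages G

  -- Low N is generated, under products and averages, by bounded functions
  -- of N - 1 coordinates; Π is a type of parameters.
  data Low {Π : Set} {n : ℕ} (N : ℕ) : (Π → Vec V n → ℚ) → Set where
    one    : Low N (λ _ _ → 1ℚ)
    factor : (B : Subset n) {u : Π → Vec V n → ℚ} → suc ∣ B ∣ ≡ N →
             (∀ p → Bounded (u p)) → (∀ p → DependsOn B (u p)) → Low N u
    mul    : {P Q : Π → Vec V n → ℚ} → Low N P → Low N Q → Low N (λ p x → P p x * Q p x)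
    avg    : (R : V → Π → Vec V n → ℚ) → (∀ y → Low N (R y)) → Low N (λ p x → E (λ y → R y p x))
    resp   : {P Q : Π → Vec V n → ℚ} → (∀ p x → P p x ≡ Q p x) → Low N P → Low N Q

  -- The recursion for `boxDual` freezes the first coordinate. It is carried as a parameter and here
  -- restored as a coordinate, which adds one coordinate to every factor.
  Low-∷-true : ∀ {Π N} {P : Π × V → Vec V n → ℚ} → Low N P → Low (suc N) (λ p x → P (p , head x) (tail x))
  Low-∷-true one = one
  Low-∷-true (factor B {u} eq bu du) = factor (true ∷ B) (cong suc eq)
    (λ p → bounded λ x → bound (bu (p , head x)) (tail x))
    (λ p → dependsOn λ { (x ∷ v) (y ∷ w) eq → step p v w (Vec.∷-injective eq) })
    where
    step : ∀ p {x y} v w → x ≡ y × restrict v B ≡ restrict w B → u (p , x) v ≡ u (p , y) w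
    step p v w (refl , eq) = depends (du (p , _)) v w eq
  Low-∷-true (mul l l′)  = mul (Low-∷-true l) (Low-∷-true l′)
  Low-∷-true (avg R l)   = avg (λ y p x → R y (p , head x) (tail x)) λ y → Low-∷-true (l y)
  Low-∷-true (resp eq l) = resp (λ p x → eq (p , head x) (tail x)) (Low-∷-true l)

  DependsOn-tail : {B : Subset n} {u : Vec V n → ℚ} → DependsOn B u → DependsOn (false ∷ B) (λ x → u (tail x))
  DependsOn-tail du = dependsOn λ { (_ ∷ v) (_ ∷ w) eq → depends du v w eq }

  Low-∷-false : ∀ {Π N} {P : Π → Vec V n → ℚ} → Low N P → Low N (λ p x → P p (tail x))
  Low-∷-false one                = one
  Low-∷-false (factor B eq bu du) = factor (false ∷ B) eq (λ p → Bounded-∘ (bu p) tail) (λ p → DependsOn-tail (du p))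
  Low-∷-false (mul l l′)         = mul (Low-∷-false l) (Low-∷-false l′)
  Low-∷-false (avg R l)          = avg (λ y p x → R y p (tail x)) λ y → Low-∷-false (l y)
  Low-∷-false (resp eq l)        = resp (λ p x → eq p (tail x)) (Low-∷-false l)

  Low-∏ : ∀ {Π N} {Y : Set} (ys : List Y) {P : Y → Π → Vec V n → ℚ} → (∀ y → Low N (P y)) → Low N (λ p x → ∏ ys (λ y → P y p x))
  Low-∏ []       l = one
  Low-∏ (y ∷ ys) l = mul (l y) (Low-∏ ys l)

  -- Every vertex in the dual function differs from the base vertex, so it takes at least one
  -- coordinate of B from the averaging variables. Once these are fixed, each factor depends on at
  -- most `∣ B ∣` - 1 coordinates.
  boxDual-low : ∀ {Π} (B : Subset n) {F : Π → Vec V n → ℚ} → (∀ p → Bounded (F p)) → (∀ p → DependsOn B (F p)) →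
    Low ∣ B ∣ (λ p → boxDual B (F p))
  boxDual-low []          bF dF = one
  boxDual-low (true ∷ B) {F} bF dF = resp (λ { p (x ∷ v) → refl })
    (avg (λ y p x → F p (y ∷ tail x) * boxDual B (λ w → F p (head x ∷ w) * F p (y ∷ w)) (tail x)) λ y → mul
      (factor (false ∷ B) refl (λ p → Bounded-∘ (bF p) (λ x → y ∷ tail x)) (λ p → DependsOn-tail (DependsOn-∷ (dF p) y)))
      (Low-∷-true (boxDual-low B (λ { (p , x) → Bounded-* (Bounded-∘ (bF p) (x ∷_)) (Bounded-∘ (bF p) (y ∷_)) })
                           (λ { (p , x) → DependsOn-* (DependsOn-∷ (dF p) x) (DependsOn-∷ (dF p) y) }))))
  boxDual-low (false ∷ B) {F} bF dF = resp
    -- F ignores a coordinate outside B, which may therefore be set to `0#`.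
    (λ { p (x ∷ v) → boxDual-cong B (λ w → depends (dF p) (0# ∷ w) (x ∷ w) refl) v })
    (Low-∷-false (boxDual-low B {λ p w → F p (0# ∷ w)} (λ p → Bounded-∘ (bF p) (0# ∷_)) (λ p → DependsOn-∷ (dF p) 0#)))

  -- A bounded version of the sets S_B.  Since weight B is 1 unless |B| = d,
  -- products may run over all subsets.
  record Weights (k d : ℕ) : Set where
    field
      weight           : Subset k → Vec V k → ℚ
      weight-bounded   : ∀ B → Bounded (weight B)
      weight-dependsOn : ∀ B → DependsOn B (weight B)
      weight-trivial   : ∀ B → ∣ B ∣ ≢ d → ∀ x → weight B x ≡ 1ℚ

    prod : Vec V k → ℚ
    prod x = ∏ (bits k) λ B → weight B x

    others : Subset k → Vec V k → ℚ
    others B x = ∏ (bits k) λ C → if does (C ≟ˢ B) then 1ℚ else weight C x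

    prod-split : ∀ B x → prod x ≡ weight B x * others B x
    prod-split B x = trans (∏-cong (bits k) λ {C} _ → pointwise C)
      (trans (∏-* (bits k) (λ C → if does (C ≟ˢ B) then weight B x else 1ℚ) _) (cong (_* others B x) (∏-bits-δ B (weight B x))))
      where
      pointwise : ∀ C → weight C x ≡ (if does (C ≟ˢ B) then weight B x else 1ℚ) * (if does (C ≟ˢ B) then 1ℚ else weight C x)
      pointwise C with C ≟ˢ B
      ... | yes refl = sym (ℚ.*-identityʳ _)
      ... | no  _    = sym (ℚ.*-identityˡ _)

    others-bounded : ∀ B → Bounded (others B)
    others-bounded B = Bounded-∏ (bits k) pointwise
      where
      pointwise : ∀ C → Bounded (λ x → if does (C ≟ˢ B) then 1ℚ else weight C x)
      pointwise C with C ≟ˢ B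
      ... | yes _ = Bounded-1
      ... | no  _ = weight-bounded C

    -- Weights at sets of size d other than B omit a coordinate of B; weights at sets of other sizes
    -- are 1. The translation by t, needed when f is eliminated, does not change which coordinates
    -- matter.
    others-missing : ∀ B → ∣ B ∣ ≡ d → ∀ t → Missing B (λ x → others B (x ⊕ᵛ t))
    others-missing B eq t = Missing-∏ B (bits k) λ {C} _ → pointwise C
      where
      pointwise : ∀ C → Missing B (λ x → if does (C ≟ˢ B) then 1ℚ else weight C (x ⊕ᵛ t))
      pointwise C with C ≟ˢ B
      ... | yes _ = Missing-1 B
      ... | no  C≢B with ∣ C ∣ ℕ.≟ d
      ...   | yes eq′ = Escapes⇒Missing (≢⇒Escapes B C (trans eq′ (sym eq)) C≢B)
                          (Bounded-∘ (weight-bounded C) (_⊕ᵛ t)) (DependsOn-shift t (weight-dependsOn C))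
      ...   | no  neq = Missing-cong (λ x → sym (weight-trivial C neq (x ⊕ᵛ t))) (Missing-1 B)

  open Weights public

  module _ {k d : ℕ} where

    trivialWeights : Weights k d
    trivialWeights = record
      { weight           = λ _ _ → 1ℚ
      ; weight-bounded   = λ _ → Bounded-1
      ; weight-dependsOn = λ _ → DependsOn-1
      ; weight-trivial   = λ _ _ _ → refl
      }

    _⊗_ : Weights k d → Weights k d → Weights k d
    W ⊗ W′ = record
      { weight           = λ B x → weight W B x * weight W′ B x
      ; weight-bounded   = λ B → Bounded-* (weight-bounded W B) (weight-bounded W′ B)
      ; weight-dependsOn = λ B → DependsOn-* (weight-dependsOn W B) (weight-dependsOn W′ B)
      ; weight-trivial   = λ B neq x → cong₂ _*_ (weight-trivial W B neq x) (weight-trivial W′ B neq x)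
      }

    update : Weights k d → (B : Subset k) → ∣ B ∣ ≡ d → {u : Vec V k → ℚ} → Bounded u → DependsOn B u → Weights k d
    update W B eq {u} bu du = record
      { weight           = w
      ; weight-bounded   = w-bounded
      ; weight-dependsOn = w-dependsOn
      ; weight-trivial   = w-trivial
      }
      where
      w : Subset k → Vec V k → ℚ
      w C x = if does (C ≟ˢ B) then u x else weight W C x
      w-bounded : ∀ C → Bounded (w C)
      w-bounded C with C ≟ˢ B
      ... | yes _ = bu
      ... | no  _ = weight-bounded W C
      w-dependsOn : ∀ C → DependsOn C (w C)
      w-dependsOn C with C ≟ˢ B
      ... | yes refl = du
      ... | no  _    = weight-dependsOn W C
      w-trivial : ∀ C → ∣ C ∣ ≢ d → ∀ x → w C x ≡ 1ℚ
      w-trivial C neq x with C ≟ˢ B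
      ... | yes refl = contradiction eq neq
      ... | no  _    = weight-trivial W C neq x

    prod-update : (W : Weights k d) (B : Subset k) (eq : ∣ B ∣ ≡ d) {u : Vec V k → ℚ} (bu : Bounded u) (du : DependsOn B u) →
      ∀ x → prod (update W B eq bu du) x ≡ u x * others W B x
    prod-update W B eq {u} bu du x = trans (∏-cong (bits k) λ {C} _ → pointwise C)
      (trans (∏-* (bits k) (λ C → if does (C ≟ˢ B) then u x else 1ℚ) _) (cong (_* others W B x) (∏-bits-δ B (u x))))
      where
      pointwise : ∀ C → (if does (C ≟ˢ B) then u x else weight W C x) ≡
        (if does (C ≟ˢ B) then u x else 1ℚ) * (if does (C ≟ˢ B) then 1ℚ else weight W C x)
      pointwise C with C ≟ˢ B
      ... | yes _ = sym (ℚ.*-identityʳ _)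
      ... | no  _ = sym (ℚ.*-identityˡ _)

    correlation : (Vec V k → ℚ) → Weights k d → ℚ
    correlation K W = Eᵛ λ x → K x * prod W x

    -- The correlation is linear in the weight at B; this is the function representing that linear
    -- functional, as `correlation-update` shows.
    dualOf : (Vec V k → ℚ) → Weights k d → Subset k → Vec V k → ℚ
    dualOf K W B = condExp B (λ x → K x * others W B x)

    dualOf-bounded : {K : Vec V k → ℚ} → Bounded K → ∀ W B → Bounded (dualOf K W B)
    dualOf-bounded bK W B = condExp-bounded B (Bounded-* bK (others-bounded W B))

    correlation-split : ∀ K (W : Weights k d) B → correlation K W ≡ Eᵛ (λ x → weight W B x * dualOf K W B x)
    correlation-split K W B = trans
      (Eᵛ-cong λ x → trans (cong (K x *_) (prod-split W B x)) (*-leftComm (K x) (weight W B x) (others W B x)))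
      (Eᵛ-condExp B _ (weight-dependsOn W B))

    correlation-update : ∀ K (W : Weights k d) B (eq : ∣ B ∣ ≡ d) {u : Vec V k → ℚ} (bu : Bounded u) (du : DependsOn B u) →
      correlation K (update W B eq bu du) ≡ Eᵛ (λ x → u x * dualOf K W B x)
    correlation-update K W B eq {u} bu du = trans
      (Eᵛ-cong λ x → trans (cong (K x *_) (prod-update W B eq bu du x)) (*-leftComm (K x) (u x) (others W B x)))
      (Eᵛ-condExp B _ du)

  -- A normal form for `Low`, with all averages outside and all products inside. It reduces a bound
  -- for `Low` functions to one for weights.
  data Hull (d : ℕ) (P : Vec V k → ℚ) : Set where
    point : (W : Weights k d) → (∀ x → P x ≡ prod W x) → Hull d P
    avg   : (R : V → Vec V k → ℚ) → (∀ y → Hull d (R y)) → (∀ x → P x ≡ E (λ y → R y x)) → Hull d P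

  Hull-* : ∀ {d} {P Q : Vec V k → ℚ} → Hull d P → Hull d Q → Hull d (λ x → P x * Q x)
  Hull-* {k} (point W eq) (point W′ eq′) = point (W ⊗ W′) λ x → trans (cong₂ _*_ (eq x) (eq′ x)) (sym (∏-* (bits k) _ _))
  Hull-* {P = P} hP@(point _ _) (avg R h eq) = avg (λ y x → P x * R y x) (λ y → Hull-* hP (h y))
    λ x → trans (cong (P x *_) (eq x)) (sym (E-*ˡ (P x) _))
  Hull-* {Q = Q} (avg R h eq) hQ = avg (λ y x → R y x * Q x) (λ y → Hull-* (h y) hQ)
    λ x → trans (cong (_* Q x) (eq x)) (sym (E-*ʳ (Q x) _))

  Hull-resp : ∀ {d} {P Q : Vec V k → ℚ} → (∀ x → P x ≡ Q x) → Hull d P → Hull d Q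
  Hull-resp eq (point W eq′) = point W λ x → trans (sym (eq x)) (eq′ x)
  Hull-resp eq (avg R h eq′) = avg R h λ x → trans (sym (eq x)) (eq′ x)

  Low⇒Hull : ∀ {Π d} {P : Π → Vec V k → ℚ} → Low (suc d) P → ∀ p → Hull d (P p)
  Low⇒Hull {k} one p = point trivialWeights λ x → sym (∏-one (bits k))
  Low⇒Hull (factor B {u} eq bu du) p = point (update trivialWeights B (ℕ.suc-injective eq) (bu p) (du p))
    λ x → sym (∏-bits-δ B (u p x))
  Low⇒Hull (mul l l′)  p = Hull-* (Low⇒Hull l p) (Low⇒Hull l′ p)
  Low⇒Hull (avg R l)   p = avg (λ y → R y p) (λ y → Low⇒Hull (l y) p) λ x → refl
  Low⇒Hull (resp eq l) p = Hull-resp (eq p) (Low⇒Hull l p)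

  -- By convexity of the power 2^m, an average of correlations obeys any bound that all of them
  -- obey.
  Hull-correlation : ∀ {d} (K : Vec V k → ℚ) m {η} → (∀ (W : Weights k d) → correlation K W ^2^ m ℚ.≤ η) →
    ∀ {P} → Hull d P → Eᵛ (λ x → K x * P x) ^2^ m ℚ.≤ η
  Hull-correlation K m bnd (point W eq) = ℚ.≤-trans (ℚ.≤-reflexive (cong (_^2^ m) (Eᵛ-cong λ x → cong (K x *_) (eq x)))) (bnd W)
  Hull-correlation K m {η} bnd {P} (avg R h eq) = begin
      Eᵛ (λ x → K x * P x) ^2^ m
        ≡⟨ cong (_^2^ m) (Eᵛ-cong λ x → trans (cong (K x *_) (eq x)) (sym (E-*ˡ (K x) _))) ⟩
      Eᵛ (λ x → E λ y → K x * R y x) ^2^ m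
        ≡⟨ cong (_^2^ m) (E-Eᵛ-swap _) ⟨
      E (λ y → Eᵛ λ x → K x * R y x) ^2^ m
        ≤⟨ E-^2^ m _ ⟩
      E (λ y → Eᵛ (λ x → K x * R y x) ^2^ m)
        ≤⟨ E-≤ (λ y → Hull-correlation K m bnd (h y)) ⟩
      η ∎
    where open ℚ.≤-Reasoning

  -- Splitting the first coordinate into a sum of two.

  merge : Vec V (suc (suc n)) → Vec V (suc n)
  merge (y ∷ z ∷ v) = (z ⊕ y) ∷ v

  sum-merge : (x : Vec V (suc (suc n))) → sum (merge x) ≡ sum x
  sum-merge (y ∷ z ∷ v) = trans (cong (_⊕ sum v) (⊕-comm z y)) (⊕-assoc y z (sum v))

  -- For fixed y the map from z to `z ⊕ y` is a translation. Together with `sum-merge` this rewrites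
  -- a correlation with `f ∘ sum` over one more coordinate.
  Eᵛ-merge : (F : Vec V (suc n) → ℚ) → Eᵛ (λ x → F (merge x)) ≡ Eᵛ F
  Eᵛ-merge F = begin
    Eᵛ (λ x → F (merge x))                          ≡⟨ trans (Eᵛ-∷ _) (E-cong λ y → Eᵛ-∷ _) ⟩
    E (λ y → E λ z → Eᵛ λ v → F ((z ⊕ y) ∷ v))      ≡⟨ E-cong (λ y → E-shift y (λ z → Eᵛ λ v → F (z ∷ v))) ⟩
    E (λ y → E λ z → Eᵛ λ v → F (z ∷ v))            ≡⟨ E-const _ ⟩
    E (λ z → Eᵛ λ v → F (z ∷ v))                    ≡⟨ Eᵛ-∷ F ⟨
    Eᵛ F                                            ∎
    where open ≡-Reasoning

  module _ (B : Subset n) (T : Vec V (suc n) → ℚ) where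

    -- The dual function of `T ∘ merge` sees y and z only through `z ⊕ y`, so its values can be read
    -- off at y = `0#`.
    splitDual : Vec V (suc n) → ℚ
    splitDual x = boxDual (true ∷ true ∷ B) (λ x → T (merge x)) (0# ∷ x)

    -- Translate the two variables averaged over by y and - y.
    boxDual-merge : ∀ x → boxDual (true ∷ true ∷ B) (λ x → T (merge x)) x ≡ splitDual (merge x)
    boxDual-merge (y ∷ z ∷ v) = begin
        boxDual (true ∷ true ∷ B) (λ x → T (merge x)) (y ∷ z ∷ v)
          ≡⟨ E-cong (λ y′ → E-*ˡ (T ((z ⊕ y′) ∷ v)) _) ⟨
        E (λ y′ → E λ z′ → g (z ⊕ y) (z ⊕ y′) (z′ ⊕ y) (z′ ⊕ y′))
          ≡⟨ E-shift y _ ⟨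
        E (λ y′ → E λ z′ → g (z ⊕ y) (z ⊕ (y′ ⊕ y)) (z′ ⊕ y) (z′ ⊕ (y′ ⊕ y)))
          ≡⟨ E-cong (λ y′ → E-shift (⊖ y) _) ⟨
        E (λ y′ → E λ z′ → g (z ⊕ y) (z ⊕ (y′ ⊕ y)) ((z′ ⊕ ⊖ y) ⊕ y) ((z′ ⊕ ⊖ y) ⊕ (y′ ⊕ y)))
          ≡⟨ E-cong (λ y′ → E-cong λ z′ → g-cong (sym (⊕-identityʳ _)) (swap y′) (trans (⊖-⊕ z′ y) (sym (⊕-identityʳ z′))) (cancel y′ z′)) ⟩
        E (λ y′ → E λ z′ → g ((z ⊕ y) ⊕ 0#) ((z ⊕ y) ⊕ y′) (z′ ⊕ 0#) (z′ ⊕ y′))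
          ≡⟨ E-cong (λ y′ → E-*ˡ (T (((z ⊕ y) ⊕ y′) ∷ v)) _) ⟩
        splitDual ((z ⊕ y) ∷ v) ∎
      where
      open ≡-Reasoning
      g : V → V → V → V → ℚ
      g a b c d = T (b ∷ v) * ((T (c ∷ v) * T (d ∷ v)) * boxDual B (λ w → (T (a ∷ w) * T (b ∷ w)) * (T (c ∷ w) * T (d ∷ w))) v)
      g-cong : ∀ {a a′ b b′ c c′ d d′} → a ≡ a′ → b ≡ b′ → c ≡ c′ → d ≡ d′ → g a b c d ≡ g a′ b′ c′ d′
      g-cong refl refl refl refl = refl
      swap : ∀ y′ → z ⊕ (y′ ⊕ y) ≡ (z ⊕ y) ⊕ y′
      swap y′ = trans (cong (z ⊕_) (⊕-comm y′ y)) (sym (⊕-assoc z y y′))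
      cancel : ∀ y′ z′ → (z′ ⊕ ⊖ y) ⊕ (y′ ⊕ y) ≡ z′ ⊕ y′
      cancel y′ z′ = trans (cong ((z′ ⊕ ⊖ y) ⊕_) (⊕-comm y′ y)) (trans (sym (⊕-assoc _ y y′)) (cong (_⊕ y′) (⊖-⊕ z′ y)))

    Box-merge : Box (true ∷ true ∷ B) (λ x → T (merge x)) ≡ Eᵛ (λ x → T x * splitDual x)
    Box-merge = trans (Box≡⟨F,boxDual⟩ (true ∷ true ∷ B) (λ x → T (merge x)))
      (trans (Eᵛ-cong λ x → cong (T (merge x) *_) (boxDual-merge x)) (Eᵛ-merge (λ x → T x * splitDual x)))

    splitDual-bounded : Bounded T → Bounded splitDual
    splitDual-bounded bT = Bounded-∘ (boxDual-bounded (true ∷ true ∷ B) (Bounded-∘ bT merge)) (0# ∷_)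

    merge-dependsOn : DependsOn (true ∷ B) T → DependsOn (true ∷ true ∷ B) (λ x → T (merge x))
    merge-dependsOn dT = dependsOn λ { (y ∷ z ∷ v) (y′ ∷ z′ ∷ v′) eq → step (Vec.∷-injective eq) }
      where
      step : ∀ {y z v y′ z′ v′} → y ≡ y′ × z ∷ restrict v B ≡ z′ ∷ restrict v′ B → T ((z ⊕ y) ∷ v) ≡ T ((z′ ⊕ y′) ∷ v′)
      step {y} {z} {v} {_} {z′} {v′} (refl , eq) = depends dT ((z ⊕ y) ∷ v) ((z′ ⊕ y) ∷ v′)
        (cong₂ _∷_ (cong (_⊕ y) (Vec.∷-injectiveˡ eq)) (Vec.∷-injectiveʳ eq))

    splitDual-dependsOn : DependsOn (true ∷ B) T → DependsOn (true ∷ B) splitDual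
    splitDual-dependsOn dT = dependsOn λ x y eq →
      depends (boxDual-dependsOn (true ∷ true ∷ B) (merge-dependsOn dT)) (0# ∷ x) (0# ∷ y) (cong (0# ∷_) eq)

    -- After `merge` the function involves `∣ B ∣` + 2 coordinates, but as a dual function it is
    -- built from factors of only `∣ B ∣` + 1. This gain is the reason for replacing weights by
    -- `splitDual`.
    splitDual-low : ∀ {Π : Set} → Bounded T → DependsOn (true ∷ B) T → Low {Π} (suc (suc ∣ B ∣)) (λ _ x → splitDual (merge x))
    splitDual-low bT dT = resp (λ _ x → boxDual-merge x)
      (boxDual-low (true ∷ true ∷ B) (λ _ → Bounded-∘ bT merge) (λ _ → merge-dependsOn dT))

  -- Puts `⊖ a` at the first coordinate outside B and `0#` elsewhere. It offsets a shift of the head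
  -- by a, leaving the total sum and the coordinates in B unchanged.
  compensate : Subset n → V → Vec V n
  compensate []          a = []
  compensate (true ∷ B)  a = 0# ∷ compensate B a
  compensate (false ∷ B) a = ⊖ a ∷ Vec.replicate _ 0#

  ⊕ᵛ-zeros : (v : Vec V n) → v ⊕ᵛ Vec.replicate n 0# ≡ v
  ⊕ᵛ-zeros []      = refl
  ⊕ᵛ-zeros (x ∷ v) = cong₂ _∷_ (⊕-identityʳ x) (⊕ᵛ-zeros v)

  sum-zeros : ∀ n → sum (Vec.replicate n 0#) ≡ 0#
  sum-zeros zero    = refl
  sum-zeros (suc n) = trans (⊕-identityˡ _) (sum-zeros n)

  sum-compensate : (B : Subset n) → ∣ B ∣ ℕ.< n → ∀ a → sum (compensate B a) ≡ ⊖ a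
  sum-compensate (true ∷ B)  lt a = trans (⊕-identityˡ _) (sum-compensate B (ℕ.s<s⁻¹ lt) a)
  sum-compensate {suc n} (false ∷ B) lt a = trans (cong (⊖ a ⊕_) (sum-zeros n)) (⊕-identityʳ (⊖ a))

  restrict-compensate : (B : Subset n) (v : Vec V n) (a : V) → restrict (v ⊕ᵛ compensate B a) B ≡ restrict v B
  restrict-compensate []          []      a = refl
  restrict-compensate (true ∷ B)  (x ∷ v) a = cong₂ _∷_ (⊕-identityʳ x) (restrict-compensate B v a)
  restrict-compensate (false ∷ B) (x ∷ v) a = cong (λ w → restrict w B) (⊕ᵛ-zeros v)

  -- Replacing weights and relating consecutive dimensions.

  module _ {f : V → ℚ} (bf : Bounded f) where

    -- Averaging over translations that preserve the sum makes `f (sum x)` a factor independent of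
    -- a, which Cauchy-Schwarz then discards.
    sum-cauchySchwarz : (H : Vec V n → ℚ) (t : V → Vec V n) → (∀ a → sum (t a) ≡ 0#) →
      Eᵛ (λ x → f (sum x) * H x) * Eᵛ (λ x → f (sum x) * H x) ℚ.≤ E (λ a → E λ b → Eᵛ λ x → H (x ⊕ᵛ t a) * H (x ⊕ᵛ t b))
    sum-cauchySchwarz H t sum-t = begin
        e * e
          ≡⟨ cong (λ e → e * e) e≡ ⟩
        Eᵛ (λ x → f (sum x) * g x) * Eᵛ (λ x → f (sum x) * g x)
          ≤⟨ Eᵛ-sq-*-≤ (λ x → f (sum x)) g (bound (Bounded-∘ bf sum)) ⟩
        Eᵛ (λ x → g x * g x)
          ≡⟨ Eᵛ-cong (λ x → E-E-* _ _) ⟩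
        Eᵛ (λ x → E λ a → E λ b → H (x ⊕ᵛ t a) * H (x ⊕ᵛ t b))
          ≡⟨ trans (E-cong λ a → E-Eᵛ-swap _) (E-Eᵛ-swap _) ⟨
        E (λ a → E λ b → Eᵛ λ x → H (x ⊕ᵛ t a) * H (x ⊕ᵛ t b)) ∎
      where
      open ℚ.≤-Reasoning
      e = Eᵛ (λ x → f (sum x) * H x)
      g : Vec V _ → ℚ
      g x = E λ a → H (x ⊕ᵛ t a)
      sum-shift : ∀ x a → sum (x ⊕ᵛ t a) ≡ sum x
      sum-shift x a = trans (sum-⊕ᵛ x (t a)) (trans (cong (sum x ⊕_) (sum-t a)) (⊕-identityʳ (sum x)))
      e≡ : e ≡ Eᵛ (λ x → f (sum x) * g x)
      e≡ = begin-equality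
        e                                                      ≡⟨ E-const e ⟨
        E (λ a → e)                                            ≡⟨ E-cong (λ a → Eᵛ-shift (t a) (λ x → f (sum x) * H x)) ⟨
        E (λ a → Eᵛ λ x → f (sum (x ⊕ᵛ t a)) * H (x ⊕ᵛ t a))    ≡⟨ E-cong (λ a → Eᵛ-cong λ x → cong (λ s → f s * H (x ⊕ᵛ t a)) (sum-shift x a)) ⟩
        E (λ a → Eᵛ λ x → f (sum x) * H (x ⊕ᵛ t a))             ≡⟨ E-Eᵛ-swap _ ⟩
        Eᵛ (λ x → E λ a → f (sum x) * H (x ⊕ᵛ t a))             ≡⟨ Eᵛ-cong (λ x → E-*ˡ (f (sum x)) _) ⟩
        Eᵛ (λ x → f (sum x) * g x)                             ∎

    f∘sum : ∀ k → Vec V k → ℚ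
    f∘sum _ x = f (sum x)

    f∘sum-bounded : ∀ k → Bounded (f∘sum k)
    f∘sum-bounded k = Bounded-∘ bf sum

    module _ {d : ℕ} (W : Weights (suc n) d) (B : Subset n) (eq : suc ∣ B ∣ ≡ d) where
      private
        C : Subset (suc n)
        C = true ∷ B
        T O : Vec V (suc n) → ℚ
        T = dualOf (f∘sum (suc n)) W C
        O = others W C
        bT : Bounded T
        bT = dualOf-bounded (f∘sum-bounded (suc n)) W C
        dT : DependsOn C T
        dT = condExp-dependsOn C _

      splitUpdate : Weights (suc n) d
      splitUpdate = update W C eq (splitDual-bounded B T bT) (splitDual-dependsOn B T dT)

      splitUpdate-low : Low {⊤} (suc d) (λ _ x → splitDual B T (merge x))
      splitUpdate-low = subst (λ N → Low {⊤} (suc N) (λ _ x → splitDual B T (merge x))) eq (splitDual-low B T bT dT)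

      -- The d + 2 squarings are one to replace the weight by T, one to remove f by translations,
      -- and d to remove `O` by the box inequality over the coordinates of C.
      correlation-splitUpdate : d ℕ.≤ n → correlation (f∘sum (suc n)) W ^2^ suc (suc d) ℚ.≤ correlation (f∘sum (suc n)) splitUpdate
      correlation-splitUpdate d≤n = begin
          (e * e) ^2^ suc d
            ≤⟨ ^2^-mono (suc d) (0≤p*p e) (begin
              e * e
                ≡⟨ cong (λ e → e * e) (correlation-split (f∘sum (suc n)) W C) ⟩
              Eᵛ (λ x → weight W C x * T x) * Eᵛ (λ x → weight W C x * T x)
                ≤⟨ Eᵛ-sq-*-≤ (weight W C) T (bound (weight-bounded W C)) ⟩
              Eᵛ (λ x → T x * T x)
                -- One of the two copies of T is expanded back into f and the other weights, the
                -- second being a function of the coordinates in C.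
                ≡⟨ Eᵛ-condExp C _ dT ⟨
              Eᵛ (λ x → T x * (f (sum x) * O x))
                ≡⟨ Eᵛ-cong (λ x → *-leftComm (T x) (f (sum x)) (O x)) ⟩
              Eᵛ (λ x → f (sum x) * (T x * O x)) ∎) ⟩
          (Eᵛ (λ x → f (sum x) * (T x * O x))) ^2^ suc d
            ≤⟨ ^2^-mono d (0≤p*p (Eᵛ (λ x → f (sum x) * (T x * O x)))) (sum-cauchySchwarz (λ x → T x * O x) t sum-t) ⟩
          E (λ a → E λ b → Eᵛ λ x → (T (x ⊕ᵛ t a) * O (x ⊕ᵛ t a)) * (T (x ⊕ᵛ t b) * O (x ⊕ᵛ t b))) ^2^ d
            ≤⟨ ℚ.≤-trans (E-^2^ d _) (E-mono λ a → E-^2^ d _) ⟩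
          E (λ a → E λ b → (Eᵛ λ x → (T (x ⊕ᵛ t a) * O (x ⊕ᵛ t a)) * (T (x ⊕ᵛ t b) * O (x ⊕ᵛ t b))) ^2^ d)
            ≤⟨ E-mono (λ a → E-mono λ b → box a b) ⟩
          E (λ a → E λ b → Box C (λ x → T (merge (a ∷ x)) * T (merge (b ∷ x))))
            -- The averages over a and b are the outermost doubled coordinate of the box average of
            -- `T ∘ merge`.
            ≡⟨ Box-merge B T ⟩
          Eᵛ (λ x → T x * splitDual B T x)
            ≡⟨ Eᵛ-cong (λ x → ℚ.*-comm (T x) (splitDual B T x)) ⟩
          Eᵛ (λ x → splitDual B T x * T x)
            ≡⟨ correlation-update (f∘sum (suc n)) W C eq (splitDual-bounded B T bT) (splitDual-dependsOn B T dT) ⟨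
          correlation (f∘sum (suc n)) splitUpdate ∎
        where
        open ℚ.≤-Reasoning
        e = correlation (f∘sum (suc n)) W
        t : V → Vec V (suc n)
        t a = a ∷ compensate B a
        sum-t : ∀ a → sum (t a) ≡ 0#
        sum-t a = trans (cong (a ⊕_) (sum-compensate B (subst (ℕ._≤ n) (sym eq) d≤n) a)) (⊕-inverseʳ a)
        -- The compensating shift lies outside B, so T sees only the shift of the head.
        T-shift : ∀ a x → T (x ⊕ᵛ t a) ≡ T (merge (a ∷ x))
        T-shift a (w ∷ v) = depends dT ((w ∷ v) ⊕ᵛ t a) ((w ⊕ a) ∷ v) (cong ((w ⊕ a) ∷_) (restrict-compensate B v a))
        box : ∀ a b → (Eᵛ λ x → (T (x ⊕ᵛ t a) * O (x ⊕ᵛ t a)) * (T (x ⊕ᵛ t b) * O (x ⊕ᵛ t b))) ^2^ d ℚ.≤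
              Box C (λ x → T (merge (a ∷ x)) * T (merge (b ∷ x)))
        box a b = begin
          (Eᵛ λ x → (T (x ⊕ᵛ t a) * O (x ⊕ᵛ t a)) * (T (x ⊕ᵛ t b) * O (x ⊕ᵛ t b))) ^2^ d
            ≡⟨ cong (_^2^ d) (Eᵛ-cong λ x → trans (*-interchange (T (x ⊕ᵛ t a)) (O (x ⊕ᵛ t a)) (T (x ⊕ᵛ t b)) (O (x ⊕ᵛ t b)))
                 (cong (_* (O (x ⊕ᵛ t a) * O (x ⊕ᵛ t b))) (cong₂ _*_ (T-shift a x) (T-shift b x)))) ⟩
          (Eᵛ λ x → (T (merge (a ∷ x)) * T (merge (b ∷ x))) * (O (x ⊕ᵛ t a) * O (x ⊕ᵛ t b))) ^2^ d
            ≡⟨ cong ((Eᵛ λ x → (T (merge (a ∷ x)) * T (merge (b ∷ x))) * (O (x ⊕ᵛ t a) * O (x ⊕ᵛ t b))) ^2^_) eq ⟨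
          (Eᵛ λ x → (T (merge (a ∷ x)) * T (merge (b ∷ x))) * (O (x ⊕ᵛ t a) * O (x ⊕ᵛ t b))) ^2^ ∣ C ∣
            ≤⟨ box-cauchySchwarz C (λ x → T (merge (a ∷ x)) * T (merge (b ∷ x))) (Missing-* (others-missing W C eq (t a)) (others-missing W C eq (t b))) ⟩
          Box C (λ x → T (merge (a ∷ x)) * T (merge (b ∷ x))) ∎

    -- The statement carried from dimension k + 1 to k. For m = 0 it is one-sided, without absolute
    -- value.
    LowBound : (d k m : ℕ) → ℚ → Set
    LowBound d k m η = ∀ {P : ⊤ → Vec V k → ℚ} → Low (suc d) P → Eᵛ (λ x → f (sum x) * P _ x) ^2^ m ℚ.≤ η

    -- A weight that ignores the first coordinate still has d coordinates after `merge`; one that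
    -- uses it would acquire another, which is why those must be treated first.
    prod-merge-low : ∀ {d} (W : Weights (suc n) d) →
      (∀ B → suc ∣ B ∣ ≡ d → Low {⊤} (suc d) (λ _ x → weight W (true ∷ B) (merge x))) →
      Low {⊤} (suc d) (λ _ x → prod W (merge x))
    prod-merge-low {n} {d} W ready = Low-∏ (bits (suc n)) pointwise
      where
      pointwise : ∀ C → Low {⊤} (suc d) (λ _ x → weight W C (merge x))
      pointwise C with ∣ C ∣ ℕ.≟ d
      ... | no neq = resp (λ _ x → sym (weight-trivial W C neq (merge x))) one
      pointwise (true ∷ B)  | yes eq = ready B eq
      pointwise (false ∷ B) | yes eq = factor (false ∷ false ∷ B) (cong suc eq) (λ _ → Bounded-∘ (weight-bounded W (false ∷ B)) merge)
        (λ _ → dependsOn λ { x@(_ ∷ _ ∷ v) y@(_ ∷ _ ∷ w) eq → depends (weight-dependsOn W (false ∷ B)) (merge x) (merge y) eq })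

    -- L lists the B whose weight at `true ∷ B` is still to be replaced, at d + 2 squarings each.
    -- When none is left, `merge` carries the correlation to one more coordinate, where the
    -- hypothesis applies.
    replaceAll : ∀ {d m η} → d ℕ.≤ n → LowBound d (suc (suc n)) m η →
      (L : List (Subset n)) → All (λ B → suc ∣ B ∣ ≡ d) L → (W : Weights (suc n) d) →
      (∀ B → suc ∣ B ∣ ≡ d → B ∉ L → Low {⊤} (suc d) (λ _ x → weight W (true ∷ B) (merge x))) →
      correlation (f∘sum (suc n)) W ^2^ (length L ℕ.* suc (suc d) ℕ.+ m) ℚ.≤ η
    replaceAll {m = m} {η} d≤n hyp [] [] W ready = ℚ.≤-trans
      (ℚ.≤-reflexive (cong (_^2^ m) (begin
        Eᵛ (λ x → f (sum x) * prod W x)                     ≡⟨ Eᵛ-merge (λ x → f (sum x) * prod W x) ⟨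
        Eᵛ (λ x → f (sum (merge x)) * prod W (merge x))     ≡⟨ Eᵛ-cong (λ x → cong (λ s → f s * prod W (merge x)) (sum-merge x)) ⟩
        Eᵛ (λ x → f (sum x) * prod W (merge x))             ∎)))
      (hyp (prod-merge-low W λ B eq → ready B eq λ ()))
      where open ≡-Reasoning
    replaceAll {n} {d} {m} {η} d≤n hyp (B ∷ L) (eq ∷ eqs) W ready = begin
        e ^2^ (suc (suc d) ℕ.+ length L ℕ.* suc (suc d) ℕ.+ m)          ≡⟨ cong (e ^2^_) (ℕ.+-assoc (suc (suc d)) (length L ℕ.* suc (suc d)) m) ⟩
        e ^2^ (suc (suc d) ℕ.+ (length L ℕ.* suc (suc d) ℕ.+ m))        ≡⟨ ^2^-+ (suc (suc d)) _ e ⟩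
        (e ^2^ suc (suc d)) ^2^ (length L ℕ.* suc (suc d) ℕ.+ m)         ≤⟨ ^2^-mono (length L ℕ.* suc (suc d) ℕ.+ m) (^2^-suc-nonneg (suc d) e) (correlation-splitUpdate W B eq d≤n) ⟩
        correlation (f∘sum (suc n)) (splitUpdate W B eq) ^2^ (length L ℕ.* suc (suc d) ℕ.+ m) ≤⟨ replaceAll {m = m} d≤n hyp L eqs (splitUpdate W B eq) ready′ ⟩
        η ∎
      where
      open ℚ.≤-Reasoning
      e = correlation (f∘sum (suc n)) W
      -- The update at B leaves the weights replaced earlier intact.
      ready′ : ∀ C → suc ∣ C ∣ ≡ d → C ∉ L → Low {⊤} (suc d) (λ _ x → weight (splitUpdate W B eq) (true ∷ C) (merge x))
      ready′ C eqC C∉L with C ≟ˢ B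
      ... | yes refl = splitUpdate-low W B eq
      ... | no  C≢B  = ready C eqC λ { (here C≡B) → C≢B C≡B ; (there C∈L) → C∉L C∈L }

    headSubsets : (d n : ℕ) → List (Subset n)
    headSubsets d n = filter (λ B → suc ∣ B ∣ ℕ.≟ d) (bits n)

    -- Convexity reduces to weights; initially every set containing the first coordinate is pending,
    -- so the readiness condition is vacuous.
    LowBound-step : ∀ {d m η} → d ℕ.≤ n → LowBound d (suc (suc n)) m η →
      LowBound d (suc n) (length (headSubsets d n) ℕ.* suc (suc d) ℕ.+ m) η
    LowBound-step {n} {d} {m} d≤n hyp l = Hull-correlation (f∘sum (suc n)) (length (headSubsets d n) ℕ.* suc (suc d) ℕ.+ m)
      (λ W → replaceAll {m = m} d≤n hyp (headSubsets d n) (all-filter _ (bits n)) W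
        λ B eq B∉ → contradiction (∈-filter⁺ (λ B → suc ∣ B ∣ ℕ.≟ d) (bits-complete B) eq) B∉)
      (Low⇒Hull l _)

∏-filter : {P : X → Set} (P? : Decidable P) (xs : List X) {f : X → ℚ} → (∀ x → ¬ P x → f x ≡ 1ℚ) →
  ∏ xs f ≡ ∏ (filter P? xs) f
∏-filter P? []       triv = refl
∏-filter P? (x ∷ xs) {f} triv with P? x
... | yes _  = cong (f x *_) (∏-filter P? xs triv)
... | no ¬Px = trans (cong₂ _*_ (triv x ¬Px) (∏-filter P? xs triv)) (ℚ.*-identityˡ _)

length-bits : ∀ n → length (bits n) ≡ 2 ℕ.^ n
length-bits zero    = refl
length-bits (suc n) = trans (List.length-++ (map (false ∷_) (bits n))) (cong₂ ℕ._+_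
  (trans (List.length-map _ (bits n)) (length-bits n))
  (trans (List.length-++ (map (true ∷_) (bits n))) (cong (ℕ._+ 0) (trans (List.length-map _ (bits n)) (length-bits n)))))

𝟙-sq≤1 : ∀ b → 𝟙 b * 𝟙 b ℚ.≤ 1ℚ
𝟙-sq≤1 true  = ℚ.≤-refl
𝟙-sq≤1 false = 0≤1

module Norms (G : FiniteAbelianGroup) where
  open Averages G
  open Structured G

  -- Gowers averages as box averages

  gowersAverage-suc : ∀ m (F : V → ℚ) → gowersAverage G (suc m) F ≡ E λ g → gowersAverage G m (λ x → F x * F (x ⊕ g))
  gowersAverage-suc m F = begin
      gowersAverage G (suc m) F
        ≡⟨ gowersAverage≡ (suc m) F ⟩
      Eᵛ (λ h → E λ x → ∏ (bits (suc m)) λ ω → F (x ⊕ dot G ω h))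
        ≡⟨ Eᵛ-∷ _ ⟩
      E (λ g → Eᵛ λ h → E λ x → ∏ (bits (suc m)) λ ω → F (x ⊕ dot G ω (g ∷ h)))
        ≡⟨ E-cong (λ g → Eᵛ-cong λ h → E-cong λ x → split g h x) ⟩
      E (λ g → Eᵛ λ h → E λ x → ∏ (bits m) λ ω → F (x ⊕ dot G ω h) * F ((x ⊕ dot G ω h) ⊕ g))
        ≡⟨ E-cong (λ g → gowersAverage≡ m (λ x → F x * F (x ⊕ g))) ⟨
      E (λ g → gowersAverage G m (λ x → F x * F (x ⊕ g))) ∎
    where
    open ≡-Reasoning
    split : ∀ g h x → ∏ (bits (suc m)) (λ ω → F (x ⊕ dot G ω (g ∷ h))) ≡ ∏ (bits m) (λ ω → F (x ⊕ dot G ω h) * F ((x ⊕ dot G ω h) ⊕ g))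
    split g h x = trans (∏-bits m (λ ω → F (x ⊕ dot G ω (g ∷ h)))) (trans (cong₂ _*_
      (∏-cong (bits m) λ {ω} _ → cong (λ y → F (x ⊕ y)) (⊕-identityˡ (dot G ω h)))
      (∏-cong (bits m) λ {ω} _ → cong F (trans (cong (x ⊕_) (⊕-comm g (dot G ω h))) (sym (⊕-assoc x (dot G ω h) g)))))
      (sym (∏-* (bits m) _ _)))

  -- The free variable c makes the induction work: a doubled coordinate x, y becomes the difference
  -- g = y - x, and F is replaced by the product of F and its translate by g.
  E-Box-sum : (B : Subset n) (F : V → ℚ) → E (λ c → Box B (λ v → F (c ⊕ sum v))) ≡ gowersAverage G ∣ B ∣ F
  E-Box-sum [] F = sym (trans (gowersAverage≡ 0 F) (trans (Eᵛ-[] _) (E-cong λ x → ℚ.*-identityʳ _)))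
  E-Box-sum (true ∷ B) F = begin
      E (λ c → E λ x → E λ y → Box B (λ v → F (c ⊕ (x ⊕ sum v)) * F (c ⊕ (y ⊕ sum v))))
        ≡⟨ trans (E-swap _) (E-cong λ x → E-swap _) ⟩
      E (λ x → E λ y → E λ c → Box B (λ v → F (c ⊕ (x ⊕ sum v)) * F (c ⊕ (y ⊕ sum v))))
        -- Translating c by `⊖ x` frees the first factor of x and leaves `y ⊕ ⊖ x` in the second.
        ≡⟨ E-cong (λ x → E-cong λ y → E-shift (⊖ x) _) ⟨
      E (λ x → E λ y → E λ c → Box B (λ v → F ((c ⊕ ⊖ x) ⊕ (x ⊕ sum v)) * F ((c ⊕ ⊖ x) ⊕ (y ⊕ sum v))))
        ≡⟨ E-cong (λ x → E-cong λ y → E-cong λ c → Box-cong B λ v → cong₂ _*_ (cong F (cancel x c (sum v))) (cong F (move x y c (sum v)))) ⟩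
      E (λ x → E λ y → E λ c → Box B (λ v → F (c ⊕ sum v) * F ((c ⊕ sum v) ⊕ (y ⊕ ⊖ x))))
        ≡⟨ E-cong (λ x → E-shift (⊖ x) (λ g → E λ c → Box B (λ v → F (c ⊕ sum v) * F ((c ⊕ sum v) ⊕ g)))) ⟩
      E (λ x → E λ g → E λ c → Box B (λ v → F (c ⊕ sum v) * F ((c ⊕ sum v) ⊕ g)))
        ≡⟨ E-const _ ⟩
      E (λ g → E λ c → Box B (λ v → F (c ⊕ sum v) * F ((c ⊕ sum v) ⊕ g)))
        ≡⟨ E-cong (λ g → E-Box-sum B (λ x → F x * F (x ⊕ g))) ⟩
      E (λ g → gowersAverage G ∣ B ∣ (λ x → F x * F (x ⊕ g)))
        ≡⟨ gowersAverage-suc ∣ B ∣ F ⟨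
      gowersAverage G (suc ∣ B ∣) F ∎
    where
    open ≡-Reasoning
    cancel : ∀ x c s → (c ⊕ ⊖ x) ⊕ (x ⊕ s) ≡ c ⊕ s
    cancel x c s = trans (sym (⊕-assoc _ x s)) (cong (_⊕ s) (⊖-⊕ c x))
    move : ∀ x y c s → (c ⊕ ⊖ x) ⊕ (y ⊕ s) ≡ (c ⊕ s) ⊕ (y ⊕ ⊖ x)
    move x y c s = trans (cong ((c ⊕ ⊖ x) ⊕_) (⊕-comm y s)) (trans (⊕-interchange c (⊖ x) s y) (cong ((c ⊕ s) ⊕_) (⊕-comm (⊖ x) y)))
  E-Box-sum (false ∷ B) F = begin
      E (λ c → E λ x → Box B (λ v → F (c ⊕ (x ⊕ sum v))))
        ≡⟨ E-swap _ ⟩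
      E (λ x → E λ c → Box B (λ v → F (c ⊕ (x ⊕ sum v))))
        ≡⟨ E-cong (λ x → E-cong λ c → Box-cong B λ v → cong F (sym (⊕-assoc c x (sum v)))) ⟩
      E (λ x → E λ c → Box B (λ v → F ((c ⊕ x) ⊕ sum v)))
        ≡⟨ E-cong (λ x → E-shift x (λ c → Box B (λ v → F (c ⊕ sum v)))) ⟩
      E (λ x → E λ c → Box B (λ v → F (c ⊕ sum v)))
        ≡⟨ E-const _ ⟩
      E (λ c → Box B (λ v → F (c ⊕ sum v)))
        ≡⟨ E-Box-sum B F ⟩
      gowersAverage G ∣ B ∣ F ∎
    where open ≡-Reasoning

  -- The first coordinate, in both copies if it is doubled, absorbs the constant c.
  Box-sum-shift : ∀ b (B : Subset n) (F : V → ℚ) c → Box (b ∷ B) (λ x → F (c ⊕ sum x)) ≡ Box (b ∷ B) (λ x → F (sum x))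
  Box-sum-shift true B F c = trans
    (E-cong λ x → trans (E-cong λ y → Box-cong B λ v → cong₂ _*_ (cong F (sym (⊕-assoc c x (sum v)))) (cong F (sym (⊕-assoc c y (sum v)))))
      (E-shiftˡ c (λ y → Box B (λ v → F ((c ⊕ x) ⊕ sum v) * F (y ⊕ sum v)))))
    (E-shiftˡ c (λ x → E λ y → Box B (λ v → F (x ⊕ sum v) * F (y ⊕ sum v))))
  Box-sum-shift false B F c = trans
    (E-cong λ x → Box-cong B λ v → cong F (sym (⊕-assoc c x (sum v))))
    (E-shiftˡ c (λ x → Box B (λ v → F (x ⊕ sum v))))

  Box-sum : (B : Subset (suc n)) (F : V → ℚ) → Box B (λ x → F (sum x)) ≡ gowersAverage G ∣ B ∣ F
  Box-sum (b ∷ B) F = trans (sym (E-const _)) (trans (E-cong λ c → sym (Box-sum-shift b B F c)) (E-Box-sum (b ∷ B) F))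

  -- From bounded functions to sets

  extend : (B : Subset k) → Vec V ∣ B ∣ → Vec V k
  extend []          []      = []
  extend (true ∷ B)  (x ∷ v) = x ∷ extend B v
  extend (false ∷ B) v       = 0# ∷ extend B v

  restrict-extend : (B : Subset k) (v : Vec V ∣ B ∣) → restrict (extend B v) B ≡ v
  restrict-extend []          []      = refl
  restrict-extend (true ∷ B)  (x ∷ v) = cong (x ∷_) (restrict-extend B v)
  restrict-extend (false ∷ B) v       = restrict-extend B v

  module _ {k d : ℕ} (K : Vec V k → ℚ) where

    IsSet : (Vec V k → ℚ) → Set
    IsSet u = Σ[ S ∈ (Vec V k → Bool) ] (∀ x → u x ≡ 𝟙 (S x))

    sets-correlation : (W : Weights k d) → (∀ B → ∣ B ∣ ≡ d → IsSet (weight W B)) → ℚ.∣ correlation K W ∣ ℚ.≤ cutNorm finite d K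
    sets-correlation W sets = ℚ.≤-trans
      (ℚ.≤-reflexive (cong ℚ.∣_∣ (trans (Eᵛ≡𝔼 _) (𝔼-cong (vectors points k) λ x → cong (K x *_) (prod≡ x)))))
      (cutNorm-upper finite d K S)
      where
      S : Family V k
      S (B , v) with ∣ B ∣ ℕ.≟ d
      ... | yes eq = proj₁ (sets B eq) (extend B v)
      ... | no  _  = true
      S≡ : ∀ B x → weight W B x ≡ 𝟙 (S (B , restrict x B))
      S≡ B x with ∣ B ∣ ℕ.≟ d
      ... | yes eq  = trans (depends (weight-dependsOn W B) x _ (sym (restrict-extend B (restrict x B)))) (proj₂ (sets B eq) _)
      ... | no  neq = weight-trivial W B neq x
      prod≡ : ∀ x → prod W x ≡ ∏ (subsetsOfSize k d) (λ B → 𝟙 (S (B , restrict x B)))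
      prod≡ x = trans (∏-filter (λ B → ∣ B ∣ ℕ.≟ d) (bits k) λ B neq → weight-trivial W B neq x)
        (∏-cong (subsetsOfSize k d) λ {B} _ → S≡ B x)

    -- With T dual to the weight at B, the correlation is at most the average of `ℚ.∣ T x ∣`, which
    -- is the difference of the correlations with the set where T is nonnegative and with its
    -- complement. Hence a factor 2 for each B.
    roundAll : (L : List (Subset k)) → All (λ B → ∣ B ∣ ≡ d) L → (W : Weights k d) →
      (∀ B → ∣ B ∣ ≡ d → B ∉ L → IsSet (weight W B)) → ℚ.∣ correlation K W ∣ ℚ.≤ 2ℚ ^ length L * cutNorm finite d K
    roundAll [] [] W sets = subst (ℚ.∣ correlation K W ∣ ℚ.≤_) (sym (ℚ.*-identityˡ _)) (sets-correlation W λ B eq → sets B eq λ ())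
    roundAll (B ∷ L) (eq ∷ eqs) W sets = begin
        ℚ.∣ correlation K W ∣
          ≡⟨ cong ℚ.∣_∣ (correlation-split K W B) ⟩
        ℚ.∣ Eᵛ (λ x → weight W B x * T x) ∣
          ≤⟨ Eᵛ-∣∣ _ ⟩
        Eᵛ (λ x → ℚ.∣ weight W B x * T x ∣)
          ≤⟨ Eᵛ-mono pointwise ⟩
        Eᵛ (λ x → 𝟙 (S x) * T x + (- 1ℚ) * (𝟙 (not (S x)) * T x))
          ≡⟨ trans (Eᵛ-+ _ _) (cong (Eᵛ (λ x → 𝟙 (S x) * T x) +_) (Eᵛ-*ˡ (- 1ℚ) _)) ⟩
        Eᵛ (λ x → 𝟙 (S x) * T x) + (- 1ℚ) * Eᵛ (λ x → 𝟙 (not (S x)) * T x)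
          ≤⟨ p≤∣p∣ _ ⟩
        ℚ.∣ Eᵛ (λ x → 𝟙 (S x) * T x) + (- 1ℚ) * Eᵛ (λ x → 𝟙 (not (S x)) * T x) ∣
          ≤⟨ ℚ.∣p+q∣≤∣p∣+∣q∣ (Eᵛ (λ x → 𝟙 (S x) * T x)) _ ⟩
        ℚ.∣ Eᵛ (λ x → 𝟙 (S x) * T x) ∣ + ℚ.∣ (- 1ℚ) * Eᵛ (λ x → 𝟙 (not (S x)) * T x) ∣
          ≡⟨ cong (ℚ.∣ Eᵛ (λ x → 𝟙 (S x) * T x) ∣ +_) (trans (ℚ.∣p*q∣≡∣p∣*∣q∣ (- 1ℚ) (Eᵛ (λ x → 𝟙 (not (S x)) * T x))) (ℚ.*-identityˡ _)) ⟩
        ℚ.∣ Eᵛ (λ x → 𝟙 (S x) * T x) ∣ + ℚ.∣ Eᵛ (λ x → 𝟙 (not (S x)) * T x) ∣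
          ≤⟨ ℚ.+-mono-≤ (rounded S dS) (rounded (λ x → not (S x)) dS′) ⟩
        c + c
          ≡⟨ cong₂ _+_ (ℚ.*-identityˡ c) (ℚ.*-identityˡ c) ⟨
        1ℚ * c + 1ℚ * c
          ≡⟨ ℚ.*-distribʳ-+ c 1ℚ 1ℚ ⟨
        2ℚ * c
          ≡⟨ ℚ.*-assoc 2ℚ (2ℚ ^ length L) _ ⟨
        2ℚ ^ suc (length L) * cutNorm finite d K ∎
      where
      open ℚ.≤-Reasoning
      c = 2ℚ ^ length L * cutNorm finite d K
      T : Vec V k → ℚ
      T = dualOf K W B
      -- The sign set of T depends only on the coordinates in B, because T does.
      S : Vec V k → Bool
      S x = does (0ℚ ℚ.≤? T x)
      dS : DependsOn B (λ x → 𝟙 (S x))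
      dS = dependsOn λ x y eq → cong (λ t → 𝟙 (does (0ℚ ℚ.≤? t))) (depends (condExp-dependsOn B _) x y eq)
      dS′ : DependsOn B (λ x → 𝟙 (not (S x)))
      dS′ = dependsOn λ x y eq → cong (λ t → 𝟙 (not (does (0ℚ ℚ.≤? t)))) (depends (condExp-dependsOn B _) x y eq)
      pointwise : ∀ x → ℚ.∣ weight W B x * T x ∣ ℚ.≤ 𝟙 (S x) * T x + (- 1ℚ) * (𝟙 (not (S x)) * T x)
      pointwise x = ℚ.≤-trans (begin
          ℚ.∣ weight W B x * T x ∣            ≡⟨ ℚ.∣p*q∣≡∣p∣*∣q∣ (weight W B x) (T x) ⟩
          ℚ.∣ weight W B x ∣ * ℚ.∣ T x ∣      ≤⟨ ℚ.*-monoʳ-≤-nonNeg ℚ.∣ T x ∣ {{ℚ.∣-∣-nonNeg (T x)}} (p*p≤1⇒∣p∣≤1 (weight W B x) (bound (weight-bounded W B) x)) ⟩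
          1ℚ * ℚ.∣ T x ∣                      ≡⟨ ℚ.*-identityˡ _ ⟩
          ℚ.∣ T x ∣                           ∎) (ℚ.≤-reflexive (abs (T x) (0ℚ ℚ.≤? T x)))
        where
        abs : ∀ t (0≤?t : Dec (0ℚ ℚ.≤ t)) → ℚ.∣ t ∣ ≡ 𝟙 (does 0≤?t) * t + (- 1ℚ) * (𝟙 (not (does 0≤?t)) * t)
        abs t (yes 0≤t) = trans (ℚ.0≤p⇒∣p∣≡p 0≤t) (sym (trans
                (cong₂ _+_ (ℚ.*-identityˡ t) (cong ((- 1ℚ) *_) (ℚ.*-zeroˡ t))) (ℚ.+-identityʳ t)))
        abs t (no 0≰t) = trans (sym (ℚ.∣-p∣≡∣p∣ t)) (trans (ℚ.0≤p⇒∣p∣≡p (ℚ.neg-antimono-≤ (ℚ.<⇒≤ (ℚ.≰⇒> 0≰t))))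
                (sym (trans (cong₂ _+_ (ℚ.*-zeroˡ t) (trans (cong ((- 1ℚ) *_) (ℚ.*-identityˡ t))
                  (trans (sym (ℚ.neg-distribˡ-* 1ℚ t)) (cong -_ (ℚ.*-identityˡ t))))) (ℚ.+-identityˡ (- t)))))
      rounded : ∀ S → DependsOn B (λ x → 𝟙 (S x)) → ℚ.∣ Eᵛ (λ x → 𝟙 (S x) * T x) ∣ ℚ.≤ c
      rounded S dS = subst (λ e → ℚ.∣ e ∣ ℚ.≤ c) (correlation-update K W B eq bS dS)
        (roundAll L eqs (update W B eq bS dS) sets′)
        where
        bS : Bounded (λ x → 𝟙 (S x))
        bS = bounded λ x → 𝟙-sq≤1 (S x)
        sets′ : ∀ C → ∣ C ∣ ≡ d → C ∉ L → IsSet (weight (update W B eq bS dS) C)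
        sets′ C eqC C∉L with C ≟ˢ B
        ... | yes _   = S , λ _ → refl
        ... | no  C≢B = sets C eqC λ { (here C≡B) → C≢B C≡B ; (there C∈L) → C∉L C∈L }

  -- Descent to d + 1 coordinates.

  module _ {f : V → ℚ} (bf : Bounded f) where

    -- The start of the descent, where no squaring has taken place.
    cutNorm-LowBound : ∀ d k → LowBound bf d k 0 (2ℚ ^ length (subsetsOfSize k d) * cutNorm finite d (λ x → f (sum {k} x)))
    cutNorm-LowBound d k l = Hull-correlation (λ x → f (sum x)) 0 (λ W → ℚ.≤-trans (p≤∣p∣ _)
        (roundAll (λ x → f (sum x)) (subsetsOfSize k d) (all-filter _ (bits k)) W
          λ B eq B∉ → contradiction (∈-filter⁺ (λ B → ∣ B ∣ ℕ.≟ d) (bits-complete B) eq) B∉))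
      (Low⇒Hull l _)

    LowBound-descend : ∀ {d η} j m → LowBound bf d (suc (j ℕ.+ d)) m η →
      ∃[ e ] e ℕ.≤ 2 ℕ.^ suc (j ℕ.+ d) ℕ.* suc (suc d) ℕ.+ m × LowBound bf d (suc d) e η
    LowBound-descend zero    m hyp = m , ℕ.m≤n+m m _ , hyp
    LowBound-descend {d} (suc j) m hyp =
      let N = 2 ℕ.^ suc (j ℕ.+ d) ℕ.* suc (suc d)
          l = length (headSubsets bf d (j ℕ.+ d)) ℕ.* suc (suc d)
          e , e≤ , bnd = LowBound-descend j (l ℕ.+ m) (LowBound-step bf {m = m} (ℕ.m≤n+m d j) hyp)
      in e , (begin
        e                            ≤⟨ e≤ ⟩
        -- Rounding `l` up to `N` makes the bound double with each dimension, so the total stays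
        -- below 2^k (d + 2).
        N ℕ.+ (l ℕ.+ m)              ≤⟨ ℕ.+-monoʳ-≤ N (ℕ.+-monoˡ-≤ m (ℕ.*-monoˡ-≤ (suc (suc d)) (begin
            length (headSubsets bf d (j ℕ.+ d))   ≤⟨ List.length-filter _ (bits (j ℕ.+ d)) ⟩
            length (bits (j ℕ.+ d))               ≡⟨ length-bits (j ℕ.+ d) ⟩
            2 ℕ.^ (j ℕ.+ d)                       ≤⟨ ℕ.m≤m+n _ _ ⟩
            2 ℕ.^ suc (j ℕ.+ d)                   ∎))) ⟩
        N ℕ.+ (N ℕ.+ m)              ≡⟨ ℕ.+-assoc N N m ⟨
        N ℕ.+ N ℕ.+ m                ≡⟨ cong (ℕ._+ m) (trans (cong (N ℕ.+_) (sym (ℕ.+-identityʳ N))) (sym (ℕ.*-assoc 2 (2 ℕ.^ suc (j ℕ.+ d)) (suc (suc d))))) ⟩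
        2 ℕ.^ suc (suc (j ℕ.+ d)) ℕ.* suc (suc d) ℕ.+ m ∎) , bnd
      where open ℕ.≤-Reasoning

    restrict-⊤ : (x y : Vec V n) → restrict x Subset.⊤ ≡ restrict y Subset.⊤ → x ≡ y
    restrict-⊤ []      []      eq = refl
    restrict-⊤ (x ∷ v) (y ∷ w) eq = cong₂ _∷_ (Vec.∷-injectiveˡ eq) (restrict-⊤ v w (Vec.∷-injectiveʳ eq))

    private
      dual : ∀ d → Vec V (suc d) → ℚ
      dual d = boxDual Subset.⊤ (λ x → f (sum x))

      gowers≡ : ∀ d → gowersAverage G (suc d) f ≡ Eᵛ (λ x → f (sum x) * dual d x)
      gowers≡ d = begin
        gowersAverage G (suc d) f                       ≡⟨ cong (λ m → gowersAverage G m f) (∣⊤∣≡n (suc d)) ⟨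
        gowersAverage G ∣ Subset.⊤ {suc d} ∣ f          ≡⟨ Box-sum (Subset.⊤ {suc d}) f ⟨
        Box (Subset.⊤ {suc d}) (λ x → f (sum x))        ≡⟨ Box≡⟨F,boxDual⟩ (Subset.⊤ {suc d}) (λ x → f (sum x)) ⟩
        Eᵛ (λ x → f (sum x) * dual d x)                 ∎
        where open ≡-Reasoning

    -- In d + 1 coordinates the dual function of `f ∘ sum` is itself built from functions of d
    -- coordinates, and its correlation is the Gowers average.
    gowersAverage-LowBound : ∀ {d e η} → LowBound bf d (suc d) e η → gowersAverage G (suc d) f ^2^ e ℚ.≤ η
    gowersAverage-LowBound {d} {e} hyp = ℚ.≤-trans (ℚ.≤-reflexive (cong (_^2^ e) (gowers≡ d)))
      (hyp (subst (λ N → Low {⊤} N (λ _ → dual d)) (∣⊤∣≡n (suc d))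
        (boxDual-low Subset.⊤ (λ _ → f∘sum-bounded bf (suc d)) λ _ → dependsOn λ x y eq → cong (λ z → f (sum z)) (restrict-⊤ x y eq))))

    gowersAverage≤1 : ∀ d → gowersAverage G (suc d) f ℚ.≤ 1ℚ
    gowersAverage≤1 d = ℚ.≤-trans (ℚ.≤-reflexive (gowers≡ d)) (Eᵛ-≤ λ x → ℚ.≤-trans (p≤∣p∣ _)
      (p*p≤1⇒∣p∣≤1 _ (bound (Bounded-* (f∘sum-bounded bf (suc d)) (boxDual-bounded Subset.⊤ (f∘sum-bounded bf (suc d)))) x)))

  subsetOfSize : ∀ m k → m ℕ.≤ k → Σ[ B ∈ Subset k ] ∣ B ∣ ≡ m
  subsetOfSize zero    zero    _   = [] , refl
  subsetOfSize zero    (suc k) _   = let B , eq = subsetOfSize zero k ℕ.z≤n in false ∷ B , eq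
  subsetOfSize (suc m) (suc k) m≤k = let B , eq = subsetOfSize m k (ℕ.s≤s⁻¹ m≤k) in true ∷ B , cong suc eq

  -- Core of part (i): the sets of an extremal family depend on d coordinates each, so each ignores
  -- one of the d + 1 coordinates in B and the box inequality over B removes them all.
  cutNorm-gowersAverage : ∀ (f : V → ℚ) d k → suc d ℕ.≤ k → cutNorm finite d (λ x → f (sum {k} x)) ^2^ suc d ℚ.≤ gowersAverage G (suc d) f
  cutNorm-gowersAverage f d (suc k) d<k = begin
      cutNorm finite d K ^2^ suc d     ≡⟨ cong (_^2^ suc d) (trans (sym (proj₂ attained)) (cong ℚ.∣_∣ (sym (Eᵛ≡𝔼 _)))) ⟩
      ℚ.∣ Eᵛ (λ x → K x * P x) ∣ ^2^ suc d ≡⟨ ∣∣^2^ d (Eᵛ (λ x → K x * P x)) ⟩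
      Eᵛ (λ x → K x * P x) ^2^ suc d   ≡⟨ cong (Eᵛ (λ x → K x * P x) ^2^_) eqB ⟨
      Eᵛ (λ x → K x * P x) ^2^ ∣ B ∣   ≤⟨ box-cauchySchwarz B K missing ⟩
      Box B K                          ≡⟨ Box-sum B f ⟩
      gowersAverage G ∣ B ∣ f          ≡⟨ cong (λ m → gowersAverage G m f) eqB ⟩
      gowersAverage G (suc d) f        ∎
    where
    open ℚ.≤-Reasoning
    K : Vec V (suc k) → ℚ
    K x = f (sum x)
    attained = cutNorm-attained finite d K
    S : Family V (suc k)
    S = proj₁ attained
    P : Vec V (suc k) → ℚ
    P x = ∏ (subsetsOfSize (suc k) d) (λ C → 𝟙 (S (C , restrict x C)))
    B : Subset (suc k)
    B = proj₁ (subsetOfSize (suc d) (suc k) d<k)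
    eqB : ∣ B ∣ ≡ suc d
    eqB = proj₂ (subsetOfSize (suc d) (suc k) d<k)
    missing : Missing B P
    missing = Missing-∏ B (subsetsOfSize (suc k) d) λ {C} C∈ → Escapes⇒Missing
      (<⇒Escapes B C (subst₂ ℕ._<_ (sym (proj₂ (∈-filter⁻ (λ C → ∣ C ∣ ℕ.≟ d) {xs = bits (suc k)} C∈))) (sym eqB) (ℕ.n<1+n d)))
      (bounded λ x → 𝟙-sq≤1 (S (C , restrict x C)))
      (dependsOn λ x y eq → cong (λ v → 𝟙 (S (C , v))) eq)

  quotient-nonneg : ∀ a n .{{_ : ℕ.NonZero n}} → 0ℚ ℚ.≤ ℤ.+ a ℚ./ n
  quotient-nonneg a n = ℚ.nonNegative⁻¹ _ {{ℚ.normalize-nonNeg a n}}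

  quotient≤1 : ∀ a n .{{_ : ℕ.NonZero n}} → a ℕ.≤ n → ℤ.+ a ℚ./ n ℚ.≤ 1ℚ
  quotient≤1 a (suc n) a≤n = ℚ.toℚᵘ-cancel-≤ (ℚᵘ.≤-respˡ-≃ (ℚᵘ.≃-sym (ℚ.toℚᵘ-fromℚᵘ (ℚᵘ.mkℚᵘ (ℤ.+ a) n)))
    (ℚᵘ.*≤* (subst₂ ℤ._≤_ (sym (ℤ.*-identityʳ (ℤ.+ a))) (sym (ℤ.*-identityˡ (ℤ.+ suc n))) (ℤ.+≤+ a≤n))))

  density-balanced : (A : V → Bool) → Bounded (λ x → 𝟙 (A x) - density G A)
  density-balanced A = bounded λ x → pointwise (A x)
    where
    δ = density G A
    0≤δ : 0ℚ ℚ.≤ δ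
    0≤δ = quotient-nonneg (length (filterᵇ A points)) size {{FiniteAbelianGroup.size-nonZero G}}
    δ≤1 : δ ℚ.≤ 1ℚ
    δ≤1 = quotient≤1 (length (filterᵇ A points)) size {{FiniteAbelianGroup.size-nonZero G}}
      (subst (length (filterᵇ A points) ℕ.≤_) length-points (List.length-filter (λ x → T? (A x)) points))
    pointwise : ∀ b → (𝟙 b - δ) * (𝟙 b - δ) ℚ.≤ 1ℚ
    pointwise true  = 0≤p≤1⇒p*p≤1 (0≤q-p δ≤1) (subst (1ℚ - δ ℚ.≤_) (ℚ.+-identityʳ 1ℚ) (ℚ.+-monoʳ-≤ 1ℚ (ℚ.neg-antimono-≤ 0≤δ)))
    pointwise false = subst (ℚ._≤ 1ℚ) (trans (sym (-p*-p≡p*p δ)) (cong (λ p → p * p) (sym (ℚ.+-identityˡ (- δ))))) (0≤p≤1⇒p*p≤1 0≤δ δ≤1)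

-- Lower cuts of roots and the size of the exponent.

root-lower⁺ : ∀ n .{{_ : ℕ.NonZero n}} x q → q ℚ.< 0ℚ ⊎ (0ℚ ℚ.≤ q × Lower x (q ^ n)) → Lower (root n x) q
root-lower⁺ (suc n) x q lower = lower

root-lower⁻ : ∀ n .{{_ : ℕ.NonZero n}} x q → Lower (root n x) q → q ℚ.< 0ℚ ⊎ (0ℚ ℚ.≤ q × Lower x (q ^ n))
root-lower⁻ (suc n) x q lower = lower

2^n*½^n≡1 : ∀ n → 2ℚ ^ n * ½ ^ n ≡ 1ℚ
2^n*½^n≡1 zero    = refl
2^n*½^n≡1 (suc n) = trans (*-interchange 2ℚ (2ℚ ^ n) ½ (½ ^ n)) (trans (cong (1ℚ *_) (2^n*½^n≡1 n)) refl)

½^n≤1 : ∀ n → ½ ^ n ℚ.≤ 1ℚ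
½^n≤1 zero    = ℚ.≤-refl
½^n≤1 (suc n) = *-mono 0≤½ 0≤1 ½≤1 (½^n≤1 n)
  where
  0≤½ : 0ℚ ℚ.≤ ½
  0≤½ = ℚ.nonNegative⁻¹ ½
  ½≤1 : ½ ℚ.≤ 1ℚ
  ½≤1 = subst (ℚ._≤ 1ℚ) (ℚ.+-identityˡ ½) (ℚ.+-monoˡ-≤ ½ (ℚ.nonNegative⁻¹ ½))

2^m*½^n≤1 : ∀ {m n} → m ℕ.≤ n → 2ℚ ^ m * ½ ^ n ℚ.≤ 1ℚ
2^m*½^n≤1 {m} {n} m≤n = begin
    2ℚ ^ m * ½ ^ n                       ≡⟨ cong (λ n → 2ℚ ^ m * ½ ^ n) (ℕ.m+[n∸m]≡n m≤n) ⟨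
    2ℚ ^ m * ½ ^ (m ℕ.+ (n ℕ.∸ m))       ≡⟨ cong (2ℚ ^ m *_) (^-homo-* ½ m (n ℕ.∸ m)) ⟩
    2ℚ ^ m * (½ ^ m * ½ ^ (n ℕ.∸ m))     ≡⟨ ℚ.*-assoc (2ℚ ^ m) (½ ^ m) _ ⟨
    2ℚ ^ m * ½ ^ m * ½ ^ (n ℕ.∸ m)       ≡⟨ cong (_* ½ ^ (n ℕ.∸ m)) (2^n*½^n≡1 m) ⟩
    1ℚ * ½ ^ (n ℕ.∸ m)                   ≡⟨ ℚ.*-identityˡ _ ⟩
    ½ ^ (n ℕ.∸ m)                        ≤⟨ ½^n≤1 (n ℕ.∸ m) ⟩
    1ℚ                                   ∎
  where open ℚ.≤-Reasoning

n≤2^n : ∀ n → n ℕ.≤ 2 ℕ.^ n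
n≤2^n zero    = ℕ.z≤n
n≤2^n (suc n) = ℕ.+-mono-≤ (ℕ.m^n>0 2 n) (ℕ.≤-trans (n≤2^n n) (ℕ.m≤m+n _ 0))

module _ (d k : ℕ) where

  2^k≤exponent : 2 ℕ.^ k ℕ.≤ (d ℕ.+ 2) ℕ.* (2 ℕ.* d ℕ.+ 2) ℕ.^ k
  2^k≤exponent = ℕ.≤-trans (ℕ.^-monoˡ-≤ k (ℕ.m≤n+m 2 (2 ℕ.* d)))
    (ℕ.m≤n*m _ (d ℕ.+ 2) {{ℕ.>-nonZero (ℕ.≤-trans (ℕ.s≤s ℕ.z≤n) (ℕ.m≤n+m 2 d))}})

  k≤exponent : k ℕ.≤ (d ℕ.+ 2) ℕ.* (2 ℕ.* d ℕ.+ 2) ℕ.^ k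
  k≤exponent = ℕ.≤-trans (n≤2^n k) 2^k≤exponent

  -- The d + 1 squarings of the uniformity norm and those of the descent are each at most 2^k (d +
  -- 2). Their sum is at most 4^k (d + 2) since 1 ≤ k, and 4 ≤ 2d + 2 since 1 ≤ d.
  exponent-large : 1 ℕ.≤ d → 1 ℕ.≤ k → suc d ℕ.+ 2 ℕ.^ k ℕ.* suc (suc d) ℕ.≤ (d ℕ.+ 2) ℕ.* (2 ℕ.* d ℕ.+ 2) ℕ.^ k
  exponent-large 1≤d 1≤k = begin
      suc d ℕ.+ N ℕ.* c                  ≤⟨ ℕ.+-monoˡ-≤ (N ℕ.* c) (ℕ.≤-trans (ℕ.n≤1+n (suc d)) (ℕ.m≤n*m c N {{ℕ.m^n≢0 2 k}})) ⟩
      N ℕ.* c ℕ.+ N ℕ.* c                ≡⟨ cong (N ℕ.* c ℕ.+_) (ℕ.+-identityʳ (N ℕ.* c)) ⟨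
      2 ℕ.* (N ℕ.* c)                    ≡⟨ ℕ.*-assoc 2 N c ⟨
      2 ℕ.^ suc k ℕ.* c                  ≤⟨ ℕ.*-monoˡ-≤ c (ℕ.^-monoʳ-≤ 2 (ℕ.≤-trans (ℕ.+-monoˡ-≤ k 1≤k) (ℕ.≤-reflexive (cong (k ℕ.+_) (sym (ℕ.+-identityʳ k)))))) ⟩
      2 ℕ.^ (2 ℕ.* k) ℕ.* c              ≡⟨ cong (ℕ._* c) (ℕ.^-*-assoc 2 2 k) ⟨
      4 ℕ.^ k ℕ.* c                      ≤⟨ ℕ.*-monoˡ-≤ c (ℕ.^-monoˡ-≤ k (ℕ.+-monoˡ-≤ 2 (ℕ.*-monoʳ-≤ 2 1≤d))) ⟩
      (2 ℕ.* d ℕ.+ 2) ℕ.^ k ℕ.* c        ≡⟨ ℕ.*-comm ((2 ℕ.* d ℕ.+ 2) ℕ.^ k) c ⟩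
      c ℕ.* (2 ℕ.* d ℕ.+ 2) ℕ.^ k        ≡⟨ cong (ℕ._* (2 ℕ.* d ℕ.+ 2) ℕ.^ k) (ℕ.+-comm 2 d) ⟩
      (d ℕ.+ 2) ℕ.* (2 ℕ.* d ℕ.+ 2) ℕ.^ k ∎
    where
    open ℕ.≤-Reasoning
    N = 2 ℕ.^ k
    c = suc (suc d)

-- From averages to norms.

module _ (G : FiniteAbelianGroup) where
  open Averages G
  open Norms G

  private
    cut : (d k : ℕ) → (V → ℚ) → ℚ
    cut d k f = cutNorm finite d (λ x → f (sum {k} x))

  cutNorm≤uniformityNorm : ∀ d k → suc d ℕ.≤ k → (f : V → ℚ) → fromℚ (cut d k f) ≤ uniformityNorm G (suc d) f
  cutNorm≤uniformityNorm d k d<k f q q<cut = root-lower⁺ (2 ℕ.^ suc d) {{ℕ.m^n≢0 2 (suc d)}} (fromℚ (gowersAverage G (suc d) f)) q cases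
    where
    cases : q ℚ.< 0ℚ ⊎ (0ℚ ℚ.≤ q × q ^ (2 ℕ.^ suc d) ℚ.< gowersAverage G (suc d) f)
    cases with q ℚ.<? 0ℚ
    ... | yes q<0 = inj₁ q<0
    ... | no  q≮0 = let 0≤q = ℚ.≮⇒≥ q≮0 in inj₂ (0≤q , subst (ℚ._< gowersAverage G (suc d) f) (^2^≡^ (suc d) q)
            (ℚ.<-≤-trans (^2^-mono-< (suc d) 0≤q q<cut) (cutNorm-gowersAverage f d k d<k)))

  gowersAverage≤cutNorm : ∀ d j {f : V → ℚ} → Bounded f → let k = suc (j ℕ.+ d) in
    ∃[ e ] e ℕ.≤ 2 ℕ.^ k ℕ.* suc (suc d) × gowersAverage G (suc d) f ^2^ e ℚ.≤ 2ℚ ^ length (subsetsOfSize k d) * cut d k f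
  gowersAverage≤cutNorm d j bf =
    let e , e≤ , bnd = LowBound-descend bf j 0 (cutNorm-LowBound bf d (suc (j ℕ.+ d)))
    in e , subst (e ℕ.≤_) (ℕ.+-identityʳ _) e≤ , gowersAverage-LowBound bf {e = e} bnd

  -- For a rational q ≥ 0 below the uniformity norm it suffices that the power 2^M of q/2 lies below
  -- the cut norm, since that is what the lower cut of the root asks of ε.
  uniformityNorm≤root : ∀ d → 1 ℕ.≤ d → (ε : ℝ) → ∀ j {f : V → ℚ} → Bounded f → let k = suc (j ℕ.+ d) in
    fromℚ (cut d k f) ≤ ε →
    uniformityNorm G (suc d) f ≤ (1ℚ + 1ℚ) · (ε ^½^ ((d ℕ.+ 2) ℕ.* (2 ℕ.* d ℕ.+ 2) ℕ.^ k))
  uniformityNorm≤root d 1≤d ε j {f} bf cut≤ε q Lq =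
      root-lower⁺ (2 ℕ.^ M) {{ℕ.m^n≢0 2 M}} ε (q * ½) (cases (root-lower⁻ (2 ℕ.^ suc d) {{ℕ.m^n≢0 2 (suc d)}} (fromℚ g) q Lq))
    where
    k₁ = suc (j ℕ.+ d)
    M = (d ℕ.+ 2) ℕ.* (2 ℕ.* d ℕ.+ 2) ℕ.^ k₁
    g = gowersAverage G (suc d) f
    c = cut d k₁ f
    l = length (subsetsOfSize k₁ d)

    0≤c : 0ℚ ℚ.≤ c
    0≤c = let S , eq = cutNorm-attained finite d (λ x → f (sum {k₁} x)) in subst (0ℚ ℚ.≤_) eq (ℚ.0≤∣p∣ _)

    l≤2^M : l ℕ.≤ 2 ℕ.^ M
    l≤2^M = ℕ.≤-trans (List.length-filter _ (bits k₁)) (ℕ.≤-trans (ℕ.≤-reflexive (length-bits k₁)) (ℕ.^-monoʳ-≤ 2 (k≤exponent d k₁)))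

    small : 0ℚ ℚ.≤ q → q ^2^ suc d ℚ.< g → (q * ½) ^2^ M ℚ.< c
    small 0≤q q<g with gowersAverage≤cutNorm d j bf
    ... | e , e≤ , g≤ = begin-strict
        (q * ½) ^2^ M                           ≡⟨ ^2^-* M q ½ ⟩
        q ^2^ M * ½ ^2^ M                       ≡⟨ cong (λ m → q ^2^ m * ½ ^2^ M) (ℕ.m+[n∸m]≡n d<M) ⟨
        q ^2^ (suc d ℕ.+ r) * ½ ^2^ M           ≡⟨ cong (_* ½ ^2^ M) (^2^-+ (suc d) r q) ⟩
        (q ^2^ suc d) ^2^ r * ½ ^2^ M           <⟨ ℚ.*-monoˡ-<-pos (½ ^2^ M) {{ℚ.positive (subst (0ℚ ℚ.<_) (sym (^2^≡^ M ½)) (^-pos (2 ℕ.^ M) (ℚ.positive⁻¹ ½)))}} (^2^-mono-< r (^2^-nonneg (suc d) 0≤q) q<g) ⟩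
        -- As 0 ≤ g ≤ 1, the r squarings left after the first d + 1 may be lowered to the e of the
        -- descent.
        g ^2^ r * ½ ^2^ M                       ≤⟨ ℚ.*-monoʳ-≤-nonNeg (½ ^2^ M) {{nonNegative 0≤½^M}} (ℚ.≤-trans (^2^-antitone e e≤r 0≤g (gowersAverage≤1 bf d)) g≤) ⟩
        2ℚ ^ l * c * ½ ^2^ M                    ≡⟨ solve 3 (λ a c b → a :* c :* b := a :* b :* c) refl (2ℚ ^ l) c (½ ^2^ M) ⟩
        2ℚ ^ l * ½ ^2^ M * c                    ≡⟨ cong (λ p → 2ℚ ^ l * p * c) (^2^≡^ M ½) ⟩
        -- The constant 2 of the conclusion, raised to the power 2^M, absorbs the rounding factor
        -- 2^l because l ≤ 2^M.
        2ℚ ^ l * ½ ^ (2 ℕ.^ M) * c              ≤⟨ ℚ.*-monoʳ-≤-nonNeg c {{nonNegative 0≤c}} (2^m*½^n≤1 l≤2^M) ⟩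
        1ℚ * c                                  ≡⟨ ℚ.*-identityˡ c ⟩
        c                                       ∎
      where
      open ℚ.≤-Reasoning
      r = M ℕ.∸ suc d
      d+e≤M : suc d ℕ.+ e ℕ.≤ M
      d+e≤M = ℕ.≤-trans (ℕ.+-monoʳ-≤ (suc d) e≤) (exponent-large d k₁ 1≤d (ℕ.s≤s ℕ.z≤n))
      d<M : suc d ℕ.≤ M
      d<M = ℕ.≤-trans (ℕ.m≤m+n (suc d) e) d+e≤M
      e≤r : e ℕ.≤ r
      e≤r = ℕ.≤-trans (ℕ.≤-reflexive (sym (ℕ.m+n∸m≡n (suc d) e))) (ℕ.∸-monoˡ-≤ (suc d) d+e≤M)
      0≤g : 0ℚ ℚ.≤ g
      0≤g = ℚ.≤-trans (^2^-nonneg (suc d) 0≤q) (ℚ.<⇒≤ q<g)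
      0≤½^M : 0ℚ ℚ.≤ ½ ^2^ M
      0≤½^M = ^2^-nonneg M (ℚ.nonNegative⁻¹ ½)

    cases : q ℚ.< 0ℚ ⊎ (0ℚ ℚ.≤ q × q ^ (2 ℕ.^ suc d) ℚ.< g) → q * ½ ℚ.< 0ℚ ⊎ (0ℚ ℚ.≤ q * ½ × Lower ε ((q * ½) ^ (2 ℕ.^ M)))
    cases (inj₁ q<0)         = inj₁ (subst (q * ½ ℚ.<_) (ℚ.*-zeroˡ ½) (ℚ.*-monoˡ-<-pos ½ q<0))
    cases (inj₂ (0≤q , q<g)) = inj₂ (*-nonneg 0≤q (ℚ.nonNegative⁻¹ ½) ,
      subst (Lower ε) (^2^≡^ M (q * ½)) (cut≤ε _ (small 0≤q (subst (ℚ._< g) (sym (^2^≡^ (suc d) q)) q<g))))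

theorem3p1 :
    (d : ℕ) → 1 ℕ.≤ d →
    (ε : ℝ) → 0ℝ < ε → ε < 1ℝ →
    (G : FiniteAbelianGroup) (A : FiniteAbelianGroup.Carrier G → Bool) →
    let δ = density G A
        ‖A-δ‖U = uniformityNorm G (d ℕ.+ 1) (λ x → 𝟙 (A x) ℚ.- δ)
        ‖Γ-δ‖□ = λ (k : ℕ) → fromℚ (cutNorm (FiniteAbelianGroup.finite G) d (λ x → 𝟙 (cayley G k A x) ℚ.- δ))
    in
    (‖A-δ‖U ≤ ε → (k : ℕ) → d ℕ.+ 1 ℕ.≤ k → ‖Γ-δ‖□ k ≤ ε)
    ×
    ((k : ℕ) → d ℕ.+ 1 ℕ.≤ k → ‖Γ-δ‖□ k ≤ ε →
      ‖A-δ‖U ≤ (1ℚ ℚ.+ 1ℚ) · (ε ^½^ ((d ℕ.+ 2) ℕ.* (2 ℕ.* d ℕ.+ 2) ℕ.^ k)))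
-- The degree is abstracted as m with m ≡ `suc d`, because `d ℕ.+ 1` does not reduce to `suc d`.
theorem3p1 d 1≤d ε _ _ G A = forward (d ℕ.+ 1) (ℕ.+-comm d 1) , backward (d ℕ.+ 1) (ℕ.+-comm d 1)
  where
  f : FiniteAbelianGroup.Carrier G → ℚ
  f x = 𝟙 (A x) - density G A
  cut : ℕ → ℝ
  cut k = fromℚ (cutNorm (FiniteAbelianGroup.finite G) d (λ x → f (FiniteAbelianGroup.sum G {k} x)))
  forward : ∀ m → m ≡ suc d → uniformityNorm G m f ≤ ε → ∀ k → m ℕ.≤ k → cut k ≤ ε
  forward _ refl U≤ε k d<k q q<cut = U≤ε q (cutNorm≤uniformityNorm G d k d<k f q q<cut)
  -- The number j of dimensions above d + 1 drives the descent.
  shifted : ∀ j k → k ≡ suc (j ℕ.+ d) → cut k ≤ ε →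
    uniformityNorm G (suc d) f ≤ (1ℚ + 1ℚ) · (ε ^½^ ((d ℕ.+ 2) ℕ.* (2 ℕ.* d ℕ.+ 2) ℕ.^ k))
  shifted j _ refl = uniformityNorm≤root G d 1≤d ε j (Norms.density-balanced G A)
  backward : ∀ m → m ≡ suc d → ∀ k → m ℕ.≤ k → cut k ≤ ε →
    uniformityNorm G m f ≤ (1ℚ + 1ℚ) · (ε ^½^ ((d ℕ.+ 2) ℕ.* (2 ℕ.* d ℕ.+ 2) ℕ.^ k))
  backward _ refl k d<k = shifted (k ℕ.∸ suc d) k (trans (sym (ℕ.m∸n+n≡m d<k)) (ℕ.+-suc (k ℕ.∸ suc d) d))
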